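{- For every fixed integer $k\ge 3$ there exist a constant $c_k>0$ and an integer $n_0$ such that for every $n\ge n_0$ with $kn$ even, the number of distinct values of $\tau(G)$, as $G$ ranges over the connected $k$-regular simple graphs on $n$ vertices, is at least $2^{c_k n}$.
   Context: For a graph $G$, $\tau(G)$ denotes the number of spanning trees of $G$. -}

module Defs where

open import Data.Bool using (Bool; true; false)
open import Data.Nat using (ℕ; zero; suc; _+_; _*_; _^_; _≤_)
open import Data.Nat.Divisibility using (_∣_)
open import Data.Fin using (Fin; zero; suc; inject₁; fromℕ)
open import Data.Vec using (Vec; lookup)
open import Data.List using (List)
open import Data.List.Membership.Propositional using (_∈_)
open import Data.List.Relation.Unary.Unique.Propositional using (Unique)
open import Data.Product using (Σ; _×_; ∃; ∃-syntax)
open import Function.Definitions using (Injective)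
open import Function.Bundles using (_⇔_)
open import Relation.Binary.PropositionalEquality using (_≡_; _≢_)
open import Relation.Nullary using (¬_)

Graph : ℕ → Set
Graph n = Vec (Vec Bool n) n

Adj : ∀ {n} → Graph n → Fin n → Fin n → Set
Adj G u v = lookup (lookup G u) v ≡ true

IsSimple : ∀ {n} → Graph n → Set
IsSimple {n} G = (∀ (u v : Fin n) → lookup (lookup G u) v ≡ lookup (lookup G v) u)
               × (∀ (u : Fin n) → lookup (lookup G u) u ≡ false)

trues : ∀ {m} → Vec Bool m → ℕ
trues Vec.[] = 0
trues (true Vec.∷ bs) = suc (trues bs)
trues (false Vec.∷ bs) = trues bs

degree : ∀ {n} → Graph n → Fin n → ℕ
degree G v = trues (lookup G v)

IsRegular : ∀ {n} → ℕ → Graph n → Set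
IsRegular {n} k G = ∀ (v : Fin n) → degree G v ≡ k

data Walk {n} (G : Graph n) : Fin n → Fin n → Set where
  here : ∀ {u} → Walk G u u
  step : ∀ {u w v} → Adj G u w → Walk G w v → Walk G u v

Connected : ∀ {n} → Graph n → Set
Connected {n} G = ∀ (u v : Fin n) → Walk G u v

Cycle : ∀ {n} → Graph n → Set
Cycle {n} G = Σ ℕ λ l → Σ (Fin (suc (suc (suc l))) → Fin n) λ f →
    Injective _≡_ _≡_ f
  × (∀ (i : Fin (suc (suc l))) → Adj G (f (inject₁ i)) (f (suc i)))
  × Adj G (f (fromℕ (suc (suc l)))) (f zero)

Acyclic : ∀ {n} → Graph n → Set
Acyclic G = ¬ Cycle G

IsTree : ∀ {n} → Graph n → Set
IsTree G = IsSimple G × Connected G × Acyclic G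

_⊆G_ : ∀ {n} → Graph n → Graph n → Set
_⊆G_ {n} H G = ∀ (u v : Fin n) → Adj H u v → Adj G u v

IsSpanningTree : ∀ {n} → Graph n → Graph n → Set
IsSpanningTree G H = H ⊆G G × IsTree H

HasTau : ∀ {n} → Graph n → ℕ → Set
HasTau {n} G t = Σ (List (Graph n)) λ L →
  Unique L × Data.List.length L ≡ t × (∀ H → (H ∈ L) ⇔ IsSpanningTree G H)

AtLeastDistinctTau : ℕ → ℕ → ℕ → Set
AtLeastDistinctTau k n m =
  Σ (Fin m → Graph n) λ G → Σ (Fin m → ℕ) λ t →
      (∀ i → IsSimple (G i) × IsRegular k (G i) × Connected (G i))
    × (∀ i → HasTau (G i) (t i))
    × Injective _≡_ _≡_ t

{-# OPTIONS --safe #-}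

-- Consider two-terminal networks, with T the number of spanning trees and F the number of spanning
-- forests consisting of two trees that separate the terminals.  Putting networks in parallel maps
-- (T , F), (T′ , F′) to (T F′ + F T′ , F F′), and attaching a pendant edge at each terminal maps
-- (T , F) to (T , F + 2 T).  Writing k + 3 for the degree, take a ladder whose rungs are bundles of
-- copies of K_{k+4} minus an edge, where a rung may contain one plain edge instead of one of the
-- copies.  Adding a rung sends the conductance y = T / F to c + y / (1 + 2 y), a value between c and
-- c + 1/2, where c is the conductance of the rung; the two kinds of rung differ by at least 1/2 in
-- conductance, so by ping-pong (T , F) determines the sequence of rungs.  Closing a ladder in two
-- ways of equal size gives two independent linear functionals of (T , F), so one of them takes at
-- least √(2 ^ L) values on the 2 ^ L ladders spelled by binary words of length L.
module Submission where

open import Defs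
open import Data.Bool using (Bool; true; false; if_then_else_; not)
open import Data.Bool.Properties using () renaming (_≟_ to _≟ᵇ_)
open import Data.Empty using (⊥; ⊥-elim)
open import Data.Fin using (Fin; zero; suc; toℕ; fromℕ; inject₁; combine)
open import Data.Fin.Properties
  using (toℕ-injective; fromℕ≢inject₁; any?; 2↔Bool; +↔⊎; 0↔⊥; injective⇒≤; combine-injective)
  renaming (_≟_ to _≟ᶠ_; suc-injective to Fin-suc-injective)
open import Data.List as List using (List; []; _∷_; _++_; map; length; allFin; deduplicate)
open import Data.List.Membership.DecPropositional using () renaming (_∈?_ to mem?)
open import Data.List.Membership.Propositional using (_∈_)
open import Data.List.Membership.Propositional.Properties
  using (∈-map⁺; ∈-map⁻; ∈-++⁺ˡ; ∈-++⁺ʳ; ∈-++⁻; ∈-allFin; ∈-lookup; ∈-deduplicate⁺; ∈-deduplicate⁻)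
open import Data.List.Properties using (map-++; map-∘; map-cong; ++-assoc; ++-identityʳ; length-++; length-map; length-tabulate)
open import Data.List.Relation.Unary.All as All using (All; []; _∷_)
import Data.List.Relation.Unary.All.Properties as All
open import Data.List.Relation.Unary.AllPairs as AllPairs using (AllPairs; []; _∷_)
import Data.List.Relation.Unary.AllPairs.Properties as AllPairs
open import Data.List.Relation.Unary.Any using (here; there; index; _─_)
open import Data.List.Relation.Unary.Any.Properties using (lookup-index)
open import Data.List.Relation.Unary.Unique.Propositional using (Unique)
import Data.List.Relation.Unary.Unique.Propositional.Properties as Unique
open import Data.Nat
open import Data.Nat.Divisibility using (_∣_; divides)
open import Data.Nat.DivMod using (_/_; _%_; m≡m%n+[m/n]*n; m%n<n)
open import Data.Nat.Properties
open import Data.Nat.Solver using (module +-*-Solver)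
open import Data.List.Relation.Unary.Unique.DecPropositional.Properties _≟_ using (deduplicate-!)
open import Data.Product as Product using (Σ; ∃; ∃₂; _×_; _,_; proj₁; proj₂; swap)
open import Data.Product.Properties using () renaming (≡-dec to ×-≡-dec)
open import Data.Sum as Sum using (_⊎_; inj₁; inj₂; [_,_])
open import Data.Sum.Function.Propositional using (_⊎-↔_)
open import Data.Sum.Properties using (inj₁-injective; inj₂-injective) renaming (≡-dec to ⊎-≡-dec)
open import Data.Unit using (⊤; tt)
open import Data.Vec using (Vec; []; _∷_; lookup; tabulate)
open import Data.Vec.Properties using (lookup∘tabulate; tabulate∘lookup; tabulate-cong; ∷-injectiveʳ)
open import Function using (_∘_; id; case_of_)
open import Function.Bundles using (mk⇔; Equivalence; _↔_; Inverse)
open import Function.Definitions using (Injective)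
open import Function.Properties.Inverse using (↔-sym; ↔-trans; ↔-refl)
open import Relation.Binary.Definitions using (DecidableEquality)
import Relation.Binary.Construct.On as On
open import Relation.Binary.PropositionalEquality hiding ([_]; J)
open import Relation.Binary.Structures using (IsEquivalence)
open import Relation.Nullary
open import Relation.Nullary.Decidable using (dec-true; dec-false; map′; does-⇔; _⊎-dec_)

-- Regularity dictates the rungs. Internal vertices of `K_{k+4}` minus an edge have degree `k + 3`
-- and its two terminals have degree `k + 2`, so a pendant edge at each terminal completes them. The
-- resulting gadget costs one unit of degree at either end, exactly as a plain edge does, and one
-- can replace the other without disturbing regularity. The exchange does change the number of
-- vertices. A binary letter is therefore not one rung but both kinds of rung, in one of two orders.
-- The residues of `n` that letters miss are reached by extra steps carrying no information. `T` and
-- `F` are introduced not by counting forests but as the coefficients of a linear law valid for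
-- every surrounding graph. Such laws compose without any surgery on trees, and the numbers
-- belonging to `K_{k+4}` minus an edge never have to be evaluated.

private variable
  X Y Z I J : Set

-- Counting spanning trees by deletion and contraction

-- Opaque, so that case distinctions on label equality are not unfolded to the boolean test on ℕ.
abstract
  _≟ˡ_ : DecidableEquality ℕ
  _≟ˡ_ = _≟_

Edges : Set → Set
Edges X = List (X × X)

mapE : (X → Y) → Edges X → Edges Y
mapE f = map (Product.map f f)

-- Contraction without quotients: the vertex set never changes, and vertices count as identified
-- when their labels agree. The class of `a` takes the label of `b`, so the direction matters for
-- the labels though not for the partition.
merge : (X → ℕ) → X → X → X → ℕ
merge ρ a b x = if does (ρ x ≟ˡ ρ a) then ρ b else ρ x

merge-hit : ∀ (ρ : X → ℕ) a b x → ρ x ≡ ρ a → merge ρ a b x ≡ ρ b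
merge-hit ρ a b x e rewrite dec-true (ρ x ≟ˡ ρ a) e = refl

merge-miss : ∀ (ρ : X → ℕ) a b x → ρ x ≢ ρ a → merge ρ a b x ≡ ρ x
merge-miss ρ a b x e rewrite dec-false (ρ x ≟ˡ ρ a) e = refl

merge-value : ∀ (ρ : X → ℕ) a b x → merge ρ a b x ≡ ρ b ⊎ merge ρ a b x ≡ ρ x
merge-value ρ a b x with ρ x ≟ˡ ρ a
... | yes _ = inj₁ refl
... | no _ = inj₂ refl

merge-mono : ∀ (ρ : X → ℕ) a b {x y} → ρ x ≡ ρ y → merge ρ a b x ≡ merge ρ a b y
merge-mono ρ a b {x} {y} e = cong (λ l → if does (l ≟ˡ ρ a) then ρ b else l) e

merge-joins : ∀ (ρ : X → ℕ) a b → merge ρ a b a ≡ merge ρ a b b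
merge-joins ρ a b with ρ b ≟ˡ ρ a
... | yes _ = merge-hit ρ a b a refl
... | no _ = merge-hit ρ a b a refl

merge-kernel : ∀ (ρ : X → ℕ) a b x y → merge ρ a b x ≡ merge ρ a b y →
  ρ x ≡ ρ y ⊎ (ρ x ≡ ρ a × ρ y ≡ ρ b) ⊎ (ρ x ≡ ρ b × ρ y ≡ ρ a)
merge-kernel ρ a b x y e with ρ x ≟ˡ ρ a | ρ y ≟ˡ ρ a
... | yes p | yes q = inj₁ (trans p (sym q))
... | yes p | no q = inj₂ (inj₁ (p , sym e))
... | no p | yes q = inj₂ (inj₂ (e , q))
... | no p | no q = inj₁ e

-- The kernel of `merge ρ a b` is the join of the kernel of `ρ` with the pair `(a , b)`, so
-- inclusions between contractions need checking on generators only.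
merge-least : ∀ {W : X → X → Set} → IsEquivalence W → (ρ : X → ℕ) → (∀ {x y} → ρ x ≡ ρ y → W x y) →
  ∀ {a b} → W a b → ∀ {x y} → merge ρ a b x ≡ merge ρ a b y → W x y
merge-least eq ρ inc {a} {b} w {x} {y} e with merge-kernel ρ a b x y e
... | inj₁ p = inc p
... | inj₂ (inj₁ (p , q)) = E.trans (inc p) (E.trans w (inc (sym q)))
  where module E = IsEquivalence eq
... | inj₂ (inj₂ (p , q)) = E.trans (inc p) (E.trans (E.sym w) (inc (sym q)))
  where module E = IsEquivalence eq

_⊑_ : (ρ σ : X → ℕ) → Set
ρ ⊑ σ = ∀ {x y} → ρ x ≡ ρ y → σ x ≡ σ y

kernel : (σ : X → ℕ) → IsEquivalence (λ x y → σ x ≡ σ y)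
kernel σ = On.isEquivalence σ isEquivalence

merge-⊑ : ∀ {ρ σ : X → ℕ} → ρ ⊑ σ → ∀ a b → merge ρ a b ⊑ merge σ a b
merge-⊑ {ρ = ρ} {σ} le a b = merge-least (kernel (merge σ a b)) ρ (λ e → merge-mono σ a b (le e)) (merge-joins σ a b)

merge-swap : ∀ (ρ : X → ℕ) a b → merge ρ a b ⊑ merge ρ b a
merge-swap ρ a b = merge-least (kernel (merge ρ b a)) ρ (merge-mono ρ b a) (sym (merge-joins ρ b a))

-- Guards the contraction branch: an edge whose ends already share a label is a loop and lies in no
-- tree.
unlessEq : (ρ : X → ℕ) → X → X → {A : Set} → A → A → A
unlessEq ρ a b z c = if does (ρ a ≟ˡ ρ b) then z else c

unlessEq-yes : ∀ (ρ : X → ℕ) a b {A : Set} {z c : A} → ρ a ≡ ρ b → unlessEq ρ a b z c ≡ z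
unlessEq-yes ρ a b e rewrite dec-true (ρ a ≟ˡ ρ b) e = refl

unlessEq-no : ∀ (ρ : X → ℕ) a b {A : Set} {z c : A} → ρ a ≢ ρ b → unlessEq ρ a b z c ≡ c
unlessEq-no ρ a b e rewrite dec-false (ρ a ≟ˡ ρ b) e = refl

AllEq : (X → ℕ) → List X → Set
AllEq ρ vs = ∀ {x y} → x ∈ vs → y ∈ vs → ρ x ≡ ρ y

abstract
  allEq? : (ρ : X → ℕ) (vs : List X) → Dec (AllEq ρ vs)
  allEq? ρ vs = map′ (λ h p q → All.lookup (All.lookup h p) q)
                     (λ h → All.tabulate (λ p → All.tabulate (λ q → h p q)))
                     (All.all? (λ x → All.all? (λ y → ρ x ≟ˡ ρ y) vs) vs)

-- The number of edge subsets which, together with the identifications already made by ρ, form a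
-- spanning tree on vs: deletion–contraction along the list.
cnt : (X → ℕ) → List X → Edges X → ℕ
cnt ρ vs [] = if does (allEq? ρ vs) then 1 else 0
cnt ρ vs ((a , b) ∷ E) = cnt ρ vs E + unlessEq ρ a b 0 (cnt (merge ρ a b) vs E)

does-cong : ∀ {A B : Set} (p : Dec A) (q : Dec B) → (A → B) → (B → A) → does p ≡ does q
does-cong p q f g = does-⇔ (mk⇔ f g) p q

unlessEq-cong : ∀ (ρ : X → ℕ) (σ : Y → ℕ) {a b c d} {m n : ℕ} → (ρ a ≡ ρ b → σ c ≡ σ d) → (σ c ≡ σ d → ρ a ≡ ρ b) →
  (ρ a ≢ ρ b → m ≡ n) → unlessEq ρ a b 0 m ≡ unlessEq σ c d 0 n
unlessEq-cong ρ σ {a} {b} {c} {d} f g h with ρ a ≟ˡ ρ b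
... | yes p = sym (unlessEq-yes σ c d (f p))
... | no p = trans (h p) (sym (unlessEq-no σ c d (p ∘ g)))

-- The recursion only ever tests labels for equality, so the partition alone matters.
cnt-kernel : ∀ {ρ σ : X → ℕ} → ρ ⊑ σ → σ ⊑ ρ → ∀ vs E → cnt ρ vs E ≡ cnt σ vs E
cnt-kernel {ρ = ρ} {σ} f g vs [] = cong (if_then 1 else 0)
  (does-cong (allEq? ρ vs) (allEq? σ vs) (λ h p q → f (h p q)) (λ h p q → g (h p q)))
cnt-kernel {ρ = ρ} {σ} f g vs ((a , b) ∷ E) = cong₂ _+_ (cnt-kernel f g vs E)
  (unlessEq-cong ρ σ f g λ _ → cnt-kernel (merge-⊑ f a b) (merge-⊑ g a b) vs E)

cnt-ext : ∀ {ρ σ : X → ℕ} → (∀ x → ρ x ≡ σ x) → ∀ vs E → cnt ρ vs E ≡ cnt σ vs E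
cnt-ext h = cnt-kernel (λ {x} {y} e → trans (sym (h x)) (trans e (h y)))
                       (λ {x} {y} e → trans (h x) (trans e (sym (h y))))

cnt-merge-swap : ∀ (ρ : X → ℕ) a b vs E → cnt (merge ρ a b) vs E ≡ cnt (merge ρ b a) vs E
cnt-merge-swap ρ a b = cnt-kernel (λ {x} {y} → merge-swap ρ a b {x} {y}) (λ {x} {y} → merge-swap ρ b a {x} {y})

cnt-map : ∀ (ρ : Y → ℕ) (f : X → Y) vs E → cnt ρ (map f vs) (mapE f E) ≡ cnt (ρ ∘ f) vs E
cnt-map ρ f vs [] = cong (if_then 1 else 0)
  (does-cong (allEq? ρ (map f vs)) (allEq? (ρ ∘ f) vs) (λ h p q → h (∈-map⁺ f p) (∈-map⁺ f q))
    λ h p q → let _ , p' , e = ∈-map⁻ f p ; _ , q' , e' = ∈-map⁻ f q in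
      trans (cong ρ e) (trans (h p' q') (cong ρ (sym e'))))
cnt-map ρ f vs ((a , b) ∷ E) = cong₂ _+_ (cnt-map ρ f vs E)
  (unlessEq-cong ρ (ρ ∘ f) id id λ _ → cnt-map (merge ρ (f a) (f b)) f vs E)

Covers : (X → ℕ) → List X → List X → Set
Covers ρ vs ws = ∀ {x} → x ∈ vs → ∃ λ y → y ∈ ws × ρ x ≡ ρ y

-- Lets a vertex drop out of the list once it has been contracted onto one that stays.
cnt-cover : ∀ (ρ : X → ℕ) {vs ws} E → Covers ρ vs ws → Covers ρ ws vs → cnt ρ vs E ≡ cnt ρ ws E
cnt-cover ρ {vs} {ws} [] f g = cong (if_then 1 else 0) (does-cong (allEq? ρ vs) (allEq? ρ ws) (back g) (back f))
  where
  back : ∀ {as bs} → Covers ρ as bs → AllEq ρ bs → AllEq ρ as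
  back c h p q = let _ , p' , e = c p ; _ , q' , e' = c q in trans e (trans (h p' q') (sym e'))
cnt-cover ρ ((a , b) ∷ E) f g = cong₂ _+_ (cnt-cover ρ E f g)
  (unlessEq-cong ρ ρ id id λ _ → cnt-cover (merge ρ a b) E (up f) (up g))
  where
  up : ∀ {as bs} → Covers ρ as bs → Covers (merge ρ a b) as bs
  up c p = let y , p' , e = c p in y , p' , merge-mono ρ a b e

-- No edge ends in the class of `x`, and contracting an edge leaves this true, so `x` is never
-- joined to `f y`.
cnt-isolated : ∀ (ρ : Y → ℕ) (f : X → Y) {vs x y} E → x ∈ vs → f y ∈ vs → (∀ z → ρ x ≢ ρ (f z)) →
  cnt ρ vs (mapE f E) ≡ 0
cnt-isolated ρ f {vs} {x} {y} [] p q iso rewrite dec-false (allEq? ρ vs) (λ h → iso y (h p q)) = refl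
cnt-isolated ρ f {vs} {x} {y} ((a , b) ∷ E) p q iso
  rewrite cnt-isolated ρ f E p q iso with ρ (f a) ≟ˡ ρ (f b)
... | yes _ = refl
... | no _ = cnt-isolated (merge ρ (f a) (f b)) f E p q iso'
  where
  iso' : ∀ z → merge ρ (f a) (f b) x ≢ merge ρ (f a) (f b) (f z)
  iso' z e with merge-kernel ρ (f a) (f b) x (f z) e
  ... | inj₁ h = iso z h
  ... | inj₂ (inj₁ (h , _)) = iso a h
  ... | inj₂ (inj₂ (h , _)) = iso b h

-- Pulls network and surroundings apart into a disjoint sum. That they share the terminals is from
-- then on expressed by equal labels.
cnt-glue : ∀ {V : Set} (ρ : Z → ℕ) (α : V → Z) (β : Y → Z) us vs D E →
  cnt ρ (map α us ++ map β vs) (mapE α D ++ mapE β E)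
    ≡ cnt [ ρ ∘ α , ρ ∘ β ] (map inj₁ us ++ map inj₂ vs) (mapE inj₁ D ++ mapE inj₂ E)
cnt-glue ρ α β us vs D E = begin
  cnt ρ (map α us ++ map β vs) (mapE α D ++ mapE β E)
    ≡⟨ cong₂ (cnt ρ) (split inj₁ inj₂ f (λ _ → refl) (λ _ → refl) us vs)
      (split (Product.map inj₁ inj₁) (Product.map inj₂ inj₂) (Product.map f f) (λ _ → refl) (λ _ → refl) D E) ⟩
  cnt ρ (map f ws) (mapE f H)
    ≡⟨ cnt-map ρ f ws H ⟩
  cnt (ρ ∘ f) ws H
    ≡⟨ cnt-ext (λ { (inj₁ _) → refl ; (inj₂ _) → refl }) ws H ⟩
  cnt [ ρ ∘ α , ρ ∘ β ] ws H ∎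
  where
  open ≡-Reasoning
  f = [ α , β ]
  ws = map inj₁ us ++ map inj₂ vs
  H = mapE inj₁ D ++ mapE inj₂ E
  split : ∀ {A B C D : Set} {a : A → C} {b : B → C} (i : A → D) (j : B → D) (h : D → C) →
    (∀ x → a x ≡ h (i x)) → (∀ x → b x ≡ h (j x)) → (xs : List A) (ys : List B) →
    map a xs ++ map b ys ≡ map h (map i xs ++ map j ys)
  split i j h p q xs ys = trans (cong₂ _++_ (trans (map-cong p xs) (map-∘ xs)) (trans (map-cong q ys) (map-∘ ys))) (sym (map-++ h (map i xs) (map j ys)))

-- Two-terminal networks

-- A two-terminal network has vertices Bool ⊎ I: two terminals and the internal vertices.  Processing
-- its edges first leaves a graph on the remaining vertices; T counts the spanning trees of the
-- network and F its spanning forests with two trees separating the terminals.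
record Transfer {I : Set} (is : List I) (D : Edges (Bool ⊎ I)) (T F : ℕ) : Set₁ where
  constructor transferBy
  field
    process : ∀ {Y Z : Set} (ρ : Z → ℕ) (α : Bool ⊎ I → Z) (β : Y → Z) (t : Bool → Y) vs E →
        (∀ {i j} → ρ (α (inj₂ i)) ≡ ρ (α (inj₂ j)) → i ≡ j) →
        (∀ i y → ρ (α (inj₂ i)) ≢ ρ (β y)) →
        (∀ b → α (inj₁ b) ≡ β (t b)) → (∀ b → t b ∈ vs) →
        cnt ρ (map (α ∘ inj₂) is ++ map β vs) (mapE α D ++ mapE β E)
        ≡ F * cnt (ρ ∘ β) vs E
        + unlessEq (ρ ∘ β) (t false) (t true) 0 (T * cnt (merge (ρ ∘ β) (t false) (t true)) vs E)

open Transfer public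

module _ {I : Set} (_≟ᴵ_ : DecidableEquality I) where

  extend : (I → Bool ⊎ I) → Bool ⊎ I → Bool ⊎ I
  extend R = [ inj₁ , R ]

  redirect : I → Bool ⊎ I → Bool ⊎ I → Bool ⊎ I
  redirect i c (inj₁ b) = inj₁ b
  redirect i c (inj₂ j) = if does (i ≟ᴵ j) then c else inj₂ j

  Placed : (Bool ⊎ I → ℕ) → (Y → ℕ) → (Bool → Y) → Set
  Placed λᵛ β t = (∀ {i j} → λᵛ (inj₂ i) ≡ λᵛ (inj₂ j) → i ≡ j) × (∀ i y → λᵛ (inj₂ i) ≢ β y)
                × (∀ b → λᵛ (inj₁ b) ≡ β (t b))

  count : List I → Edges (Bool ⊎ I) → (I → Bool ⊎ I) → (Bool ⊎ I → ℕ) → (Y → ℕ) → List Y → Edges Y → ℕ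
  count is D R λᵛ β vs E = cnt [ λᵛ ∘ extend R , β ] (map inj₁ (map inj₂ is) ++ map inj₂ vs) (mapE inj₁ D ++ mapE inj₂ E)

  -- Transfer for a partially contracted network: R sends each internal vertex to the vertex it has
  -- been contracted to.
  record Contracted (is : List I) (D : Edges (Bool ⊎ I)) (R : I → Bool ⊎ I) (T F : ℕ) : Set₁ where
    constructor contractedBy
    field
      processing : ∀ {Y : Set} (λᵛ : Bool ⊎ I → ℕ) (β : Y → ℕ) (t : Bool → Y) vs E →
            Placed λᵛ β t → (∀ b → t b ∈ vs) →
            count is D R λᵛ β vs E ≡ F * cnt β vs E + unlessEq β (t false) (t true) 0 (T * cnt (merge β (t false) (t true)) vs E)

  open Contracted

  private
    zeroT : ∀ {Y : Set} (β : Y → ℕ) a b F m → F ≡ F + unlessEq β a b 0 (0 * m)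
    zeroT β a b F m with β a ≟ˡ β b
    ... | yes _ = sym (+-identityʳ F)
    ... | no _ = sym (+-identityʳ F)

  -- With no edges left, success means that every internal vertex has been absorbed by a terminal.
  -- Then `F` is 1, otherwise 0; `T` is 0 because `R` never identifies the terminals.
  contracted-[] : ∀ is R → ∃ λ F → Contracted is [] R 0 F
  contracted-[] is R with All.all? (λ i → isTerminal? (R i)) is
    where
    isTerminal? : (v : Bool ⊎ I) → Dec (∃ λ b → v ≡ inj₁ b)
    isTerminal? (inj₁ b) = yes (b , refl)
    isTerminal? (inj₂ i) = no λ ()
  ... | yes h = 1 , contractedBy λ λᵛ β t vs E (inj , fresh , ter) tvs → begin
      cnt [ λᵛ ∘ extend R , β ] (map inj₁ (map inj₂ is) ++ map inj₂ vs) (mapE inj₂ E)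
        ≡⟨ cnt-cover _ (mapE inj₂ E)
             (λ p → Sum.[ (λ q → absorbed λᵛ β t ter tvs q) , (λ q → _ , q , refl) ] (∈-++⁻ (map inj₁ (map inj₂ is)) p))
             (λ q → _ , ∈-++⁺ʳ _ q , refl) ⟩
      cnt [ λᵛ ∘ extend R , β ] (map inj₂ vs) (mapE inj₂ E)
        ≡⟨ cnt-map _ inj₂ vs E ⟩
      cnt β vs E
        ≡⟨ sym (+-identityʳ _) ⟩
      1 * cnt β vs E
        ≡⟨ zeroT β (t false) (t true) _ (cnt (merge β (t false) (t true)) vs E) ⟩
      1 * cnt β vs E + unlessEq β (t false) (t true) 0 0 ∎
    where
    open ≡-Reasoning
    absorbed : ∀ {Y : Set} λᵛ (β : Y → ℕ) t {vs} → (∀ b → λᵛ (inj₁ b) ≡ β (t b)) → (∀ b → t b ∈ vs) → ∀ {x} →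
      x ∈ map inj₁ (map inj₂ is) → ∃ λ y → y ∈ map inj₂ vs × [ λᵛ ∘ extend R , β ] x ≡ [ λᵛ ∘ extend R , β ] y
    absorbed λᵛ β t ter tvs q with ∈-map⁻ inj₁ q
    ... | _ , q' , refl with ∈-map⁻ inj₂ q'
    ... | i , q'' , refl with All.lookup h q''
    ... | b , e = inj₂ (t b) , ∈-map⁺ inj₂ (tvs b) , trans (cong λᵛ e) (ter b)
  ... | no ¬h = 0 , contractedBy λ λᵛ β t vs E (inj , fresh , ter) tvs →
      trans (cnt-isolated _ inj₂ E (∈-++⁺ˡ (∈-map⁺ inj₁ (∈-map⁺ inj₂ i∈))) (∈-++⁺ʳ _ (∈-map⁺ inj₂ (tvs false)))
               (λ y e → fresh j y (trans (cong λᵛ (sym Ri)) e)))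
            (zeroT β (t false) (t true) 0 (cnt (merge β (t false) (t true)) vs E))
    where
    stray : ∃ λ i → i ∈ is × ∃ λ j → R i ≡ inj₂ j
    stray = go is ¬h
      where
      go : ∀ is → ¬ All (λ i → ∃ λ b → R i ≡ inj₁ b) is → ∃ λ i → i ∈ is × ∃ λ j → R i ≡ inj₂ j
      go [] n = ⊥-elim (n All.[])
      go (i ∷ is) n with R i in eq
      ... | inj₂ j = i , here refl , j , eq
      ... | inj₁ b = let i' , p , r = go is (λ a → n ((b , eq) All.∷ a)) in i' , there p , r
    i∈ = proj₁ (proj₂ stray)
    j = proj₁ (proj₂ (proj₂ stray))
    Ri = proj₂ (proj₂ (proj₂ stray))

  -- The labels agree pointwise, not merely up to kernel, because `merge` gives the class of the
  -- internal end `a` the label of its target. For this the internal end has to come first.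
  merge-redirect : ∀ {Y : Set} R (λᵛ : Bool ⊎ I → ℕ) (β : Y → ℕ) t → Placed λᵛ β t → ∀ {i c} a b →
    extend R a ≡ inj₂ i → extend R b ≡ c → ∀ x →
    merge [ λᵛ ∘ extend R , β ] (inj₁ a) (inj₁ b) x ≡ [ λᵛ ∘ extend (redirect i c ∘ R) , β ] x
  merge-redirect R λᵛ β t (inj , fresh , ter) {i} a b ea eb (inj₂ y) =
    merge-miss [ λᵛ ∘ extend R , β ] (inj₁ a) (inj₁ b) (inj₂ y) (λ e → fresh i y (trans (cong λᵛ (sym ea)) (sym e)))
  merge-redirect R λᵛ β t (inj , fresh , ter) {i} {c} a b ea eb (inj₁ (inj₁ s)) =
    merge-miss [ λᵛ ∘ extend R , β ] (inj₁ a) (inj₁ b) (inj₁ (inj₁ s))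
      (λ e → fresh i (t s) (trans (cong λᵛ (sym ea)) (trans (sym e) (ter s))))
  merge-redirect R λᵛ β t (inj , fresh , ter) {i} {c} a b ea eb (inj₁ (inj₂ v)) = go (R v) refl
    where
    σ = [ λᵛ ∘ extend R , β ]
    go : ∀ w → R v ≡ w → merge σ (inj₁ a) (inj₁ b) (inj₁ (inj₂ v)) ≡ λᵛ (redirect i c (R v))
    go (inj₁ s) ev = trans (merge-miss σ (inj₁ a) (inj₁ b) (inj₁ (inj₂ v))
        (λ e → fresh i (t s) (trans (cong λᵛ (sym ea)) (trans (sym e) (trans (cong λᵛ ev) (ter s))))))
      (trans (cong λᵛ ev) (sym (cong (λᵛ ∘ redirect i c) ev)))
    go (inj₂ j) ev with i ≟ᴵ j in eq
    ... | yes refl = trans (merge-hit σ (inj₁ a) (inj₁ b) (inj₁ (inj₂ v)) (cong λᵛ (trans ev (sym ea))))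
      (trans (cong λᵛ eb) (sym (cong λᵛ (trans (cong (redirect i c) ev) (cong (λ d → if does d then c else inj₂ i) eq)))))
    ... | no i≢j = trans (merge-miss σ (inj₁ a) (inj₁ b) (inj₁ (inj₂ v))
        (λ e → i≢j (inj (trans (cong λᵛ (sym ea)) (trans (sym e) (cong λᵛ ev))))))
      (trans (cong λᵛ ev) (sym (cong λᵛ (trans (cong (redirect i c) ev) (cong (λ d → if does d then c else inj₂ j) eq)))))

  private
    both : ∀ {Y : Set} (β : Y → ℕ) a b T₁ F₁ T₂ F₂ m n →
      (F₁ * m + unlessEq β a b 0 (T₁ * n)) + (F₂ * m + unlessEq β a b 0 (T₂ * n))
        ≡ (F₁ + F₂) * m + unlessEq β a b 0 ((T₁ + T₂) * n)
    both β a b T₁ F₁ T₂ F₂ m n with β a ≟ˡ β b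
    ... | yes _ = solve 3 (λ F₁ F₂ m → (F₁ :* m :+ con 0) :+ (F₂ :* m :+ con 0) := (F₁ :+ F₂) :* m :+ con 0) refl F₁ F₂ m
      where open +-*-Solver
    ... | no _ = solve 6 (λ T₁ F₁ T₂ F₂ m n → (F₁ :* m :+ T₁ :* n) :+ (F₂ :* m :+ T₂ :* n)
                    := (F₁ :+ F₂) :* m :+ (T₁ :+ T₂) :* n) refl T₁ F₁ T₂ F₂ m n
      where open +-*-Solver

  skip : ∀ {is D R a b T F} → extend R a ≡ extend R b → Contracted is D R T F → Contracted is ((a , b) ∷ D) R T F
  skip {a = a} {b} e H = contractedBy λ λᵛ β t vs E pl tvs →
    trans (cong₂ _+_ (processing H λᵛ β t vs E pl tvs) (unlessEq-yes [ λᵛ ∘ extend _ , β ] (inj₁ a) (inj₁ b) (cong λᵛ e))) (+-identityʳ _)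

  split : ∀ {is D R a b T₁ F₁ T₂ F₂} R' →
    (∀ {Y : Set} λᵛ (β : Y → ℕ) t → Placed λᵛ β t → λᵛ (extend R a) ≢ λᵛ (extend R b)) →
    (∀ {Y : Set} λᵛ (β : Y → ℕ) t → Placed λᵛ β t → ∀ vs E →
      cnt (merge [ λᵛ ∘ extend R , β ] (inj₁ a) (inj₁ b)) vs E ≡ cnt [ λᵛ ∘ extend R' , β ] vs E) →
    Contracted is D R T₁ F₁ → Contracted is D R' T₂ F₂ → Contracted is ((a , b) ∷ D) R (T₁ + T₂) (F₁ + F₂)
  split {is} {D} {a = a} {b} {T₁} {F₁} {T₂} {F₂} R' ne me H₁ H₂ = contractedBy λ λᵛ β t vs E pl tvs →
    trans (cong₂ _+_ (processing H₁ λᵛ β t vs E pl tvs)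
            (trans (unlessEq-no [ λᵛ ∘ extend _ , β ] (inj₁ a) (inj₁ b) (ne λᵛ β t pl))
              (trans (me λᵛ β t pl (map inj₁ (map inj₂ is) ++ map inj₂ vs) (mapE inj₁ D ++ mapE inj₂ E)) (processing H₂ λᵛ β t vs E pl tvs))))
          (both β (t false) (t true) T₁ F₁ T₂ F₂ _ _)

  module _ {is : List I} {D : Edges (Bool ⊎ I)} {R : I → Bool ⊎ I} {a b : Bool ⊎ I} {T F : ℕ} where
    -- Contracting an edge between the terminals cannot be recorded in `R`, which keeps them apart.
    -- The identification is handed to the surroundings instead, and the same law is applied again
    -- with labels `β'`. There the `T` term vanishes, and each forest counted by `F` has become a
    -- tree, whence `T + F`.
    bridging : ∀ s s' → s ≢ s' → extend R a ≡ inj₁ s → extend R b ≡ inj₁ s' → Contracted is D R T F →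
      ∀ {Y : Set} (λᵛ : Bool ⊎ I → ℕ) (β : Y → ℕ) (t : Bool → Y) vs E → Placed λᵛ β t → (∀ b → t b ∈ vs) →
      count is ((a , b) ∷ D) R λᵛ β vs E ≡ F * cnt β vs E + unlessEq β (t false) (t true) 0 ((T + F) * cnt (merge β (t false) (t true)) vs E)
    bridging s s' s≢ ea eb H {Y} λᵛ β t vs E pl@(inj , fresh , ter) tvs with β (t s) ≟ˡ β (t s')
    ... | yes p = trans (cong₂ _+_ (processing H λᵛ β t vs E pl tvs)
                    (unlessEq-yes [ λᵛ ∘ extend R , β ] (inj₁ a) (inj₁ b) (eqλ p)))
                  (trans (+-identityʳ _) (cong (F * cnt β vs E +_)
                    (trans (unlessEq-yes β (t false) (t true) (both-eq s s' s≢ p)) (sym (unlessEq-yes β (t false) (t true) (both-eq s s' s≢ p))))))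
      where
      eqλ : β (t s) ≡ β (t s') → λᵛ (extend R a) ≡ λᵛ (extend R b)
      eqλ p = trans (cong λᵛ ea) (trans (ter s) (trans p (trans (sym (ter s')) (sym (cong λᵛ eb)))))
      both-eq : ∀ s s' → s ≢ s' → β (t s) ≡ β (t s') → β (t false) ≡ β (t true)
      both-eq false false n _ = ⊥-elim (n refl)
      both-eq false true _ e = e
      both-eq true false _ e = sym e
      both-eq true true n _ = ⊥-elim (n refl)
    ... | no p = begin
        count is D R λᵛ β vs E + unlessEq [ λᵛ ∘ extend R , β ] (inj₁ a) (inj₁ b) 0 (cnt (merge [ λᵛ ∘ extend R , β ] (inj₁ a) (inj₁ b)) ws G)
          ≡⟨ cong₂ _+_ (processing H λᵛ β t vs E pl tvs) (unlessEq-no [ λᵛ ∘ extend R , β ] (inj₁ a) (inj₁ b) neλ) ⟩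
        X₁ + cnt (merge [ λᵛ ∘ extend R , β ] (inj₁ a) (inj₁ b)) ws G
          ≡⟨ cong (X₁ +_) (cnt-ext pointwise ws G) ⟩
        X₁ + count is D R λ' β' vs E
          ≡⟨ cong (X₁ +_) (processing H λ' β' t vs E pl' tvs) ⟩
        X₁ + (F * cnt β' vs E + unlessEq β' (t false) (t true) 0 (T * cnt (merge β' (t false) (t true)) vs E))
          ≡⟨ cong (λ z → X₁ + (F * cnt β' vs E + z)) (unlessEq-yes β' (t false) (t true) (orient s s' s≢)) ⟩
        X₁ + (F * cnt β' vs E + 0)
          ≡⟨ cong₂ _+_ (cong (F * cnt β vs E +_) (unlessEq-no β (t false) (t true) neβ))
                       (cong (λ z → F * z + 0) (unflip s s' s≢)) ⟩
        (F * cnt β vs E + T * C) + (F * C + 0)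
          ≡⟨ solve 4 (λ F T C B → (F :* B :+ T :* C) :+ (F :* C :+ con 0) := F :* B :+ (T :+ F) :* C) refl F T C (cnt β vs E) ⟩
        F * cnt β vs E + (T + F) * C
          ≡⟨ cong (F * cnt β vs E +_) (sym (unlessEq-no β (t false) (t true) neβ)) ⟩
        F * cnt β vs E + unlessEq β (t false) (t true) 0 ((T + F) * C) ∎
      where
      open ≡-Reasoning
      open +-*-Solver
      ws = map inj₁ (map inj₂ is) ++ map inj₂ vs
      G = mapE inj₁ D ++ mapE inj₂ E
      X₁ = F * cnt β vs E + unlessEq β (t false) (t true) 0 (T * cnt (merge β (t false) (t true)) vs E)
      C = cnt (merge β (t false) (t true)) vs E
      β' : Y → ℕ
      β' = merge β (t s) (t s')
      λ' : Bool ⊎ I → ℕ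
      λ' = [ β' ∘ t , λᵛ ∘ inj₂ ]
      σ = [ λᵛ ∘ extend R , β ]
      la : λᵛ (extend R a) ≡ β (t s)
      la = trans (cong λᵛ ea) (ter s)
      lb : λᵛ (extend R b) ≡ β (t s')
      lb = trans (cong λᵛ eb) (ter s')
      neλ : λᵛ (extend R a) ≢ λᵛ (extend R b)
      neλ e = p (trans (sym la) (trans e lb))
      merged-at : ∀ x y → σ x ≡ β y → merge σ (inj₁ a) (inj₁ b) x ≡ β' y
      merged-at x y e = case β y ≟ˡ β (t s) of λ where
        (yes h) → trans (merge-hit σ (inj₁ a) (inj₁ b) x (trans e (trans h (sym la)))) (trans lb (sym (merge-hit β (t s) (t s') y h)))
        (no h) → trans (merge-miss σ (inj₁ a) (inj₁ b) x (λ q → h (trans (sym e) (trans q la)))) (trans e (sym (merge-miss β (t s) (t s') y h)))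
      pointwise : ∀ x → merge σ (inj₁ a) (inj₁ b) x ≡ [ λ' ∘ extend R , β' ] x
      pointwise (inj₂ y) = merged-at (inj₂ y) y refl
      pointwise (inj₁ (inj₁ r)) = merged-at (inj₁ (inj₁ r)) (t r) (ter r)
      pointwise (inj₁ (inj₂ v)) = go (R v) refl
        where
        go : ∀ c → R v ≡ c → merge σ (inj₁ a) (inj₁ b) (inj₁ (inj₂ v)) ≡ λ' (R v)
        go (inj₁ r) e = trans (merged-at (inj₁ (inj₂ v)) (t r) (trans (cong λᵛ e) (ter r))) (sym (cong λ' e))
        go (inj₂ j) e = trans (merge-miss σ (inj₁ a) (inj₁ b) (inj₁ (inj₂ v)) (λ q → fresh j (t s) (trans (sym (cong λᵛ e)) (trans q la))))
                              (trans (cong λᵛ e) (sym (cong λ' e)))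
      fresh' : ∀ i y → λᵛ (inj₂ i) ≢ β' y
      fresh' i y e = Sum.[ (λ h → fresh i (t s') (trans e h)) , (λ h → fresh i y (trans e h)) ] (merge-value β (t s) (t s') y)
      pl' : Placed λ' β' t
      pl' = inj , fresh' , λ _ → refl
      orient : ∀ s s' → s ≢ s' → merge β (t s) (t s') (t false) ≡ merge β (t s) (t s') (t true)
      orient false false n = ⊥-elim (n refl)
      orient false true _ = merge-joins β (t false) (t true)
      orient true false _ = sym (merge-joins β (t true) (t false))
      orient true true n = ⊥-elim (n refl)
      unflip : ∀ s s' → s ≢ s' → cnt (merge β (t s) (t s')) vs E ≡ C
      unflip false false n = ⊥-elim (n refl)
      unflip false true _ = refl
      unflip true false _ = cnt-merge-swap β (t true) (t false) vs E
      unflip true true n = ⊥-elim (n refl)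
      neβ : β (t false) ≢ β (t true)
      neβ = go s s' s≢ p
        where
        go : ∀ s s' → s ≢ s' → β (t s) ≢ β (t s') → β (t false) ≢ β (t true)
        go false false n = ⊥-elim (n refl)
        go false true _ h = h
        go true false _ h = h ∘ sym
        go true true n = ⊥-elim (n refl)

    bridgeTerminals : ∀ s s' → s ≢ s' → extend R a ≡ inj₁ s → extend R b ≡ inj₁ s' →
      Contracted is D R T F → Contracted is ((a , b) ∷ D) R (T + F) F
    bridgeTerminals s s' s≢ ea eb H = contractedBy (bridging s s' s≢ ea eb H)

  -- Deletion and contraction on the network alone, with the surroundings left variable. The current
  -- positions of the two ends decide between a loop, a bridge of the terminals and a redirection.
  contracted : ∀ is D R → ∃₂ λ T F → Contracted is D R T F
  contracted is [] R = 0 , contracted-[] is R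
  contracted is ((a , b) ∷ D) R with contracted is D R | extend R a in ea | extend R b in eb
  ... | T , F , H | inj₁ false | inj₁ false = T , F , skip (trans ea (sym eb)) H
  ... | T , F , H | inj₁ true | inj₁ true = T , F , skip (trans ea (sym eb)) H
  ... | T , F , H | inj₁ false | inj₁ true = T + F , F , bridgeTerminals false true (λ ()) ea eb H
  ... | T , F , H | inj₁ true | inj₁ false = T + F , F , bridgeTerminals true false (λ ()) ea eb H
  ... | T , F , H | inj₁ s | inj₂ j = let T' , F' , H' = contracted is D (redirect j (inj₁ s) ∘ R) in
    _ , _ , split (redirect j (inj₁ s) ∘ R)
      (λ λᵛ β t (_ , fresh , ter) e → fresh j (t s) (trans (sym (cong λᵛ eb)) (trans (sym e) (trans (cong λᵛ ea) (ter s)))))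
      -- It is the internal end that must move onto the terminal, so the edge is contracted in the
      -- reverse direction.
      (λ λᵛ β t pl vs E → trans (cnt-merge-swap [ λᵛ ∘ extend R , β ] (inj₁ a) (inj₁ b) vs E)
                                (cnt-ext (merge-redirect R λᵛ β t pl b a eb ea) vs E)) H H'
  ... | T , F , H | inj₂ i | inj₁ s = let T' , F' , H' = contracted is D (redirect i (inj₁ s) ∘ R) in
    _ , _ , split (redirect i (inj₁ s) ∘ R)
      (λ λᵛ β t (_ , fresh , ter) e → fresh i (t s) (trans (sym (cong λᵛ ea)) (trans e (trans (cong λᵛ eb) (ter s)))))
      (λ λᵛ β t pl vs E → cnt-ext (merge-redirect R λᵛ β t pl a b ea eb) vs E) H H'
  ... | T , F , H | inj₂ i | inj₂ j with i ≟ᴵ j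
  ... | yes refl = T , F , skip (trans ea (sym eb)) H
  ... | no i≢j = let T' , F' , H' = contracted is D (redirect i (inj₂ j) ∘ R) in
    _ , _ , split (redirect i (inj₂ j) ∘ R)
      (λ λᵛ β t (inj , _) e → i≢j (inj (trans (sym (cong λᵛ ea)) (trans e (cong λᵛ eb)))))
      (λ λᵛ β t pl vs E → cnt-ext (merge-redirect R λᵛ β t pl a b ea eb) vs E) H H'

  transfer : ∀ is D → ∃₂ λ T F → Transfer is D T F
  transfer is D = let T , F , H = contracted is D inj₂ in
    T , F , transferBy λ ρ α β t vs E inj fresh ter tvs →
      trans (trans (cong (λ us → cnt ρ (us ++ map β vs) (mapE α D ++ mapE β E)) (map-∘ is)) (cnt-glue ρ α β (map inj₂ is) vs D E))
      (trans (cnt-ext (λ { (inj₁ (inj₁ _)) → refl ; (inj₁ (inj₂ _)) → refl ; (inj₂ _) → refl }) _ (mapE inj₁ D ++ mapE inj₂ E))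
      (processing H (ρ ∘ α) (ρ ∘ β) t vs E (inj , fresh , λ b → cong ρ (ter b)) tvs))

-- Composition of networks

relocate : ∀ {A B C D V W : Set} {f : V → D} {g : A → V} {h : B → V} {k : C → D}
  (a : A → D) (b : W → D) (c : B → W) (d : C → W) →
  (∀ x → f (g x) ≡ a x) → (∀ y → f (h y) ≡ b (c y)) → (∀ z → k z ≡ b (d z)) → ∀ xs ys zs →
  map f (map g xs ++ map h ys) ++ map k zs ≡ map a xs ++ map b (map c ys ++ map d zs)
relocate {f = f} {g} {h} {k} a b c d p q r xs ys zs = begin
  map f (map g xs ++ map h ys) ++ map k zs
    ≡⟨ cong (_++ map k zs) (trans (map-++ f (map g xs) _) (cong₂ _++_ (sym (map-∘ xs)) (sym (map-∘ ys)))) ⟩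
  (map (f ∘ g) xs ++ map (f ∘ h) ys) ++ map k zs
    ≡⟨ ++-assoc (map (f ∘ g) xs) _ _ ⟩
  map (f ∘ g) xs ++ map (f ∘ h) ys ++ map k zs
    ≡⟨ cong₂ _++_ (map-cong p xs) (cong₂ _++_ (map-cong q ys) (map-cong r zs)) ⟩
  map a xs ++ map (b ∘ c) ys ++ map (b ∘ d) zs
    ≡⟨ cong (map a xs ++_) (trans (cong₂ _++_ (map-∘ ys) (map-∘ zs)) (sym (map-++ b (map c ys) _))) ⟩
  map a xs ++ map b (map c ys ++ map d zs) ∎
  where open ≡-Reasoning

transfer-edge : Transfer {⊥} [] ((inj₁ false , inj₁ true) ∷ []) 1 1
transfer-edge = transferBy λ ρ α β t vs E inj fresh ter tvs → begin
  cnt ρ (map β vs) ((α (inj₁ false) , α (inj₁ true)) ∷ mapE β E)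
    ≡⟨ cong₂ (λ x y → cnt ρ (map β vs) ((x , y) ∷ mapE β E)) (ter false) (ter true) ⟩
  cnt ρ (map β vs) (mapE β ((t false , t true) ∷ E))
    ≡⟨ cnt-map ρ β vs ((t false , t true) ∷ E) ⟩
  cnt (ρ ∘ β) vs E + unlessEq (ρ ∘ β) (t false) (t true) 0 (cnt (merge (ρ ∘ β) (t false) (t true)) vs E)
    ≡⟨ cong₂ (λ x y → x + unlessEq (ρ ∘ β) (t false) (t true) 0 y) (sym (+-identityʳ _)) (sym (+-identityʳ _)) ⟩
  1 * cnt (ρ ∘ β) vs E + unlessEq (ρ ∘ β) (t false) (t true) 0 (1 * cnt (merge (ρ ∘ β) (t false) (t true)) vs E) ∎
  where open ≡-Reasoning

parallel : ∀ {I J : Set} → Edges (Bool ⊎ I) → Edges (Bool ⊎ J) → Edges (Bool ⊎ (I ⊎ J))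
parallel D₁ D₂ = mapE (Sum.map₂ inj₁) D₁ ++ mapE (Sum.map₂ inj₂) D₂

-- The second network first counts as part of the surroundings of the first. It is then processed
-- twice: with the terminals apart, and with the terminals merged, where its own `T₂` term
-- disappears.
transfer-parallel : ∀ {is js D₁ D₂ T₁ F₁ T₂ F₂} → Transfer {I} is D₁ T₁ F₁ → Transfer {J} js D₂ T₂ F₂ →
  Transfer (map inj₁ is ++ map inj₂ js) (parallel D₁ D₂) (T₁ * F₂ + F₁ * T₂) (F₁ * F₂)
transfer-parallel {I} {J} {is} {js} {D₁} {D₂} {T₁} {F₁} {T₂} {F₂} H₁ H₂ = transferBy λ {Y} {Z} ρ α β t vs E inj fresh ter tvs → let
      α₁ = α ∘ Sum.map₂ inj₁
      β₁ : J ⊎ Y → Z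
      β₁ = [ α ∘ inj₂ ∘ inj₂ , β ]
      put : Bool ⊎ J → J ⊎ Y
      put = [ inj₂ ∘ t , inj₁ ]
      put-ok : ∀ v → α (Sum.map₂ inj₂ v) ≡ β₁ (put v)
      put-ok = λ { (inj₁ b) → ter b ; (inj₂ j) → refl }
      σ = ρ ∘ β₁
      a = t false
      b = t true
      σ' = merge σ (inj₂ a) (inj₂ b)
      keep : ∀ j → σ' (inj₁ j) ≡ σ (inj₁ j)
      keep = λ j → merge-miss σ (inj₂ a) (inj₂ b) (inj₁ j) (fresh (inj₂ j) a)
      vs₁ = map inj₁ js ++ map inj₂ vs
      E₁ = mapE put D₂ ++ mapE inj₂ E
      B = cnt (ρ ∘ β) vs E
      C = cnt (merge (ρ ∘ β) a b) vs E
    in begin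
    cnt ρ (map (α ∘ inj₂) (map inj₁ is ++ map inj₂ js) ++ map β vs) (mapE α (parallel D₁ D₂) ++ mapE β E)
      ≡⟨ cong₂ (cnt ρ) (relocate (α₁ ∘ inj₂) β₁ inj₁ inj₂ (λ _ → refl) (λ _ → refl) (λ _ → refl) is js vs)
           (relocate (Product.map α₁ α₁) (Product.map β₁ β₁) (Product.map put put) (Product.map inj₂ inj₂)
             (λ _ → refl) (λ (x , y) → cong₂ _,_ (put-ok x) (put-ok y)) (λ _ → refl) D₁ D₂ E) ⟩
    cnt ρ (map (α₁ ∘ inj₂) is ++ map β₁ vs₁) (mapE α₁ D₁ ++ mapE β₁ E₁)
      ≡⟨ process H₁ ρ α₁ β₁ (inj₂ ∘ t) vs₁ E₁ (λ e → inj₁-injective (inj e))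
           (λ { i (inj₁ j) e → case inj e of λ () ; i (inj₂ y) → fresh (inj₁ i) y }) ter
           (λ b → ∈-++⁺ʳ (map inj₁ js) (∈-map⁺ inj₂ (tvs b))) ⟩
    F₁ * cnt σ vs₁ E₁ + unlessEq σ (inj₂ a) (inj₂ b) 0 (T₁ * cnt σ' vs₁ E₁)
      ≡⟨ cong₂ _+_ (cong (F₁ *_) (process H₂ σ put inj₂ t vs E (λ e → inj₂-injective (inj e))
             (λ j y → fresh (inj₂ j) y) (λ _ → refl) tvs))
           (cong (λ z → unlessEq (ρ ∘ β) a b 0 (T₁ * z)) (process H₂ σ' put inj₂ t vs E
             (λ {i} {j} e → inj₂-injective (inj (trans (sym (keep i)) (trans e (keep j)))))
             (λ j y e → case merge-value (ρ ∘ β) a b y of λ where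
                (inj₁ h) → fresh (inj₂ j) b (trans (sym (keep j)) (trans e h))
                (inj₂ h) → fresh (inj₂ j) y (trans (sym (keep j)) (trans e h)))
             (λ _ → refl) tvs)) ⟩
    F₁ * (F₂ * B + unlessEq (ρ ∘ β) a b 0 (T₂ * C))
      + unlessEq (ρ ∘ β) a b 0 (T₁ * (F₂ * C + unlessEq (merge (ρ ∘ β) a b) a b 0 (T₂ * cnt (merge (merge (ρ ∘ β) a b) a b) vs E)))
      ≡⟨ cong (λ z → F₁ * (F₂ * B + unlessEq (ρ ∘ β) a b 0 (T₂ * C)) + unlessEq (ρ ∘ β) a b 0 (T₁ * (F₂ * C + z)))
           (unlessEq-yes (merge (ρ ∘ β) a b) a b (merge-joins (ρ ∘ β) a b)) ⟩
    F₁ * (F₂ * B + unlessEq (ρ ∘ β) a b 0 (T₂ * C)) + unlessEq (ρ ∘ β) a b 0 (T₁ * (F₂ * C + 0))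
      ≡⟨ collect (ρ ∘ β) a b B C ⟩
    F₁ * F₂ * B + unlessEq (ρ ∘ β) a b 0 ((T₁ * F₂ + F₁ * T₂) * C) ∎
  where
  open ≡-Reasoning
  open +-*-Solver
  collect : ∀ {Y : Set} (ρ : Y → ℕ) a b B C →
    F₁ * (F₂ * B + unlessEq ρ a b 0 (T₂ * C)) + unlessEq ρ a b 0 (T₁ * (F₂ * C + 0))
      ≡ F₁ * F₂ * B + unlessEq ρ a b 0 ((T₁ * F₂ + F₁ * T₂) * C)
  collect ρ a b B C with ρ a ≟ˡ ρ b
  ... | yes _ = solve 3 (λ F₁ F₂ B → F₁ :* (F₂ :* B :+ con 0) :+ con 0 := F₁ :* F₂ :* B :+ con 0) refl F₁ F₂ B
  ... | no _ = solve 6 (λ F₁ F₂ T₁ T₂ B C → F₁ :* (F₂ :* B :+ T₂ :* C) :+ T₁ :* (F₂ :* C :+ con 0)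
      := F₁ :* F₂ :* B :+ (T₁ :* F₂ :+ F₁ :* T₂) :* C) refl F₁ F₂ T₁ T₂ B C

extension : Edges (Bool ⊎ I) → Edges (Bool ⊎ (Bool ⊎ I))
extension D = mapE inj₂ D ++ map (λ b → inj₂ (inj₁ b) , inj₁ b) (false ∷ true ∷ [])

module _ (ρ : Bool ⊎ Y → ℕ) (t : Bool → Y) (vs : List Y) (E : Edges Y) (tvs : ∀ b → t b ∈ vs)
         (distinct : ρ (inj₁ false) ≢ ρ (inj₁ true)) (fresh : ∀ b y → ρ (inj₁ b) ≢ ρ (inj₂ y)) where
  private
    β : Y → ℕ
    β = ρ ∘ inj₂
    vs′ : List (Bool ⊎ Y)
    vs′ = inj₁ false ∷ inj₁ true ∷ map inj₂ vs
    E₀ E₁ E₂ : Edges (Bool ⊎ Y)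
    E₀ = mapE inj₂ E
    E₁ = (inj₁ true , inj₂ (t true)) ∷ E₀
    E₂ = (inj₁ false , inj₂ (t false)) ∷ E₁
    pair : ℕ → ℕ → Bool ⊎ Y → ℕ
    pair g h (inj₁ false) = g
    pair g h (inj₁ true) = h
    pair g h (inj₂ y) = β y
    g h : ℕ
    g = ρ (inj₁ false)
    h = ρ (inj₁ true)

    absorb : ∀ σ → (∀ b → ∃ λ s → σ (inj₁ b) ≡ σ (inj₂ (t s))) → cnt σ vs′ E₀ ≡ cnt (σ ∘ inj₂) vs E
    absorb σ e = trans (cnt-cover σ E₀ (λ where
        (here refl) → at false
        (there (here refl)) → at true
        (there (there p)) → _ , p , refl) (λ p → _ , there (there p) , refl))
      (cnt-map σ inj₂ vs E)
      where
      at : ∀ b → ∃ λ y → y ∈ map inj₂ vs × σ (inj₁ b) ≡ σ y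
      at b = let s , q = e b in _ , ∈-map⁺ inj₂ (tvs s) , q

    isolated : ∀ σ b → (∀ y → σ (inj₁ b) ≢ σ (inj₂ y)) → cnt σ vs′ E₀ ≡ 0
    isolated σ b iso = cnt-isolated σ inj₂ E (place b) (there (there (∈-map⁺ inj₂ (tvs false)))) iso
      where
      place : ∀ b → inj₁ b ∈ vs′
      place false = here refl
      place true = there (here refl)

    choose : ∀ σ b D → (∀ y → σ (inj₁ b) ≢ σ (inj₂ y)) → ∀ τ → (∀ x → merge σ (inj₁ b) (inj₂ (t b)) x ≡ τ x) →
      cnt σ vs′ ((inj₁ b , inj₂ (t b)) ∷ D) ≡ cnt σ vs′ D + cnt τ vs′ D
    choose σ b D iso τ e = cong (cnt σ vs′ D +_) (trans (unlessEq-no σ (inj₁ b) (inj₂ (t b)) (iso (t b))) (cnt-ext e vs′ D))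

    hit = λ (σ : Bool ⊎ Y → ℕ) b x → merge-hit σ (inj₁ b) (inj₂ (t b)) x
    miss = λ (σ : Bool ⊎ Y → ℕ) b x → merge-miss σ (inj₁ b) (inj₂ (t b)) x

  -- Of the four subsets of the two pendant edges only the full one survives: dropping an edge
  -- isolates an old terminal.
  spokes-separate : cnt ρ vs′ E₂ ≡ cnt β vs E
  spokes-separate = begin
    cnt ρ vs′ E₂
      ≡⟨ choose ρ false E₁ (fresh false) (pair (β (t false)) h) (λ where
           (inj₁ false) → hit ρ false (inj₁ false) refl
           (inj₁ true) → miss ρ false (inj₁ true) (distinct ∘ sym)
           (inj₂ y) → miss ρ false (inj₂ y) (fresh false y ∘ sym)) ⟩
    cnt ρ vs′ E₁ + cnt (pair (β (t false)) h) vs′ E₁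
      ≡⟨ cong₂ _+_
           (choose ρ true E₀ (fresh true) (pair g (β (t true))) (λ where
             (inj₁ false) → miss ρ true (inj₁ false) distinct
             (inj₁ true) → hit ρ true (inj₁ true) refl
             (inj₂ y) → miss ρ true (inj₂ y) (fresh true y ∘ sym)))
           (choose (pair (β (t false)) h) true E₀ (fresh true) (pair (β (t false)) (β (t true))) (λ where
             (inj₁ false) → miss (pair (β (t false)) h) true (inj₁ false) (fresh true (t false) ∘ sym)
             (inj₁ true) → hit (pair (β (t false)) h) true (inj₁ true) refl
             (inj₂ y) → miss (pair (β (t false)) h) true (inj₂ y) (fresh true y ∘ sym))) ⟩
    (cnt ρ vs′ E₀ + cnt (pair g (β (t true))) vs′ E₀)
      + (cnt (pair (β (t false)) h) vs′ E₀ + cnt (pair (β (t false)) (β (t true))) vs′ E₀)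
      ≡⟨ cong₂ _+_ (cong₂ _+_ (isolated ρ false (fresh false)) (isolated (pair g (β (t true))) false (fresh false)))
           (cong₂ _+_ (isolated (pair (β (t false)) h) true (fresh true))
             (absorb (pair (β (t false)) (β (t true))) λ { false → false , refl ; true → true , refl })) ⟩
    cnt β vs E ∎
    where open ≡-Reasoning

  -- The old terminals now form one vertex. Keeping one pendant edge hangs it on the rest, in two
  -- ways. Keeping both joins the new terminals through it, which closes a cycle when these already
  -- share a label.
  spokes-joined : cnt (merge ρ (inj₁ false) (inj₁ true)) vs′ E₂
    ≡ 2 * cnt β vs E + unlessEq β (t false) (t true) 0 (cnt (merge β (t false) (t true)) vs E)
  spokes-joined = begin
    cnt (merge ρ (inj₁ false) (inj₁ true)) vs′ E₂
      ≡⟨ cnt-ext (λ where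
           (inj₁ false) → merge-hit ρ (inj₁ false) (inj₁ true) (inj₁ false) refl
           (inj₁ true) → merge-miss ρ (inj₁ false) (inj₁ true) (inj₁ true) (distinct ∘ sym)
           (inj₂ y) → merge-miss ρ (inj₁ false) (inj₁ true) (inj₂ y) (fresh false y ∘ sym)) vs′ E₂ ⟩
    cnt (pair h h) vs′ E₂
      ≡⟨ choose (pair h h) false E₁ (fresh true) σ (λ where
           (inj₁ false) → hit (pair h h) false (inj₁ false) refl
           (inj₁ true) → hit (pair h h) false (inj₁ true) refl
           (inj₂ y) → miss (pair h h) false (inj₂ y) (fresh true y ∘ sym)) ⟩
    cnt (pair h h) vs′ E₁ + cnt σ vs′ E₁
      ≡⟨ cong₂ _+_ (choose (pair h h) true E₀ (fresh true) σ' (λ where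
           (inj₁ false) → hit (pair h h) true (inj₁ false) refl
           (inj₁ true) → hit (pair h h) true (inj₁ true) refl
           (inj₂ y) → miss (pair h h) true (inj₂ y) (fresh true y ∘ sym)))
           (cong₂ _+_ (absorb σ (λ { false → false , refl ; true → false , refl }))
             (cong (unlessEq β (t false) (t true) 0) (absorb (merge σ (inj₁ true) (inj₂ (t true)))
               λ b → true , trans (merge-mono σ (inj₁ true) (inj₂ (t true)) {inj₁ b} {inj₁ true} (flat b)) (merge-joins σ (inj₁ true) (inj₂ (t true)))))) ⟩
    (cnt (pair h h) vs′ E₀ + cnt σ' vs′ E₀) + (cnt β vs E + unlessEq β (t false) (t true) 0 (cnt (merge β (t false) (t true)) vs E))
      ≡⟨ cong (_+ (cnt β vs E + unlessEq β (t false) (t true) 0 (cnt (merge β (t false) (t true)) vs E)))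
           (cong₂ _+_ (isolated (pair h h) true (fresh true)) (absorb σ' (λ { false → true , refl ; true → true , refl }))) ⟩
    cnt β vs E + (cnt β vs E + unlessEq β (t false) (t true) 0 (cnt (merge β (t false) (t true)) vs E))
      ≡⟨ solve 2 (λ x y → x :+ (x :+ y) := con 2 :* x :+ y) refl (cnt β vs E) _ ⟩
    2 * cnt β vs E + unlessEq β (t false) (t true) 0 (cnt (merge β (t false) (t true)) vs E) ∎
    where
    open ≡-Reasoning
    open +-*-Solver
    σ = pair (β (t false)) (β (t false))
    σ' = pair (β (t true)) (β (t true))
    flat : ∀ b → σ (inj₁ b) ≡ β (t false)
    flat false = refl
    flat true = refl

transfer-extension : ∀ {is D T F} → Transfer {I} is D T F →
  Transfer (map inj₂ is ++ map inj₁ (false ∷ true ∷ [])) (extension D) T (F + 2 * T)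
transfer-extension {I} {is} {D} {T} {F} H = transferBy λ {Y} {Z} ρ α β t vs E inj fresh ter tvs → let
      β₁ : Bool ⊎ Y → Z
      β₁ = [ α ∘ inj₂ ∘ inj₁ , β ]
      σ = ρ ∘ β₁
      vs₁ = inj₁ false ∷ inj₁ true ∷ map inj₂ vs
      E₁ = (inj₁ false , inj₂ (t false)) ∷ (inj₁ true , inj₂ (t true)) ∷ mapE inj₂ E
      a = t false
      b = t true
      B = cnt (ρ ∘ β) vs E
      C = cnt (merge (ρ ∘ β) a b) vs E
      distinct : σ (inj₁ false) ≢ σ (inj₁ true)
      distinct = λ e → case inj e of λ ()
      fresh₁ : ∀ b y → σ (inj₁ b) ≢ σ (inj₂ y)
      fresh₁ = λ b y → fresh (inj₁ b) y
    in begin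
    cnt ρ (map (α ∘ inj₂) (map inj₂ is ++ map inj₁ (false ∷ true ∷ [])) ++ map β vs) (mapE α (extension D) ++ mapE β E)
      ≡⟨ cong₂ (cnt ρ) (relocate (α ∘ inj₂ ∘ inj₂) β₁ inj₁ inj₂ (λ _ → refl) (λ _ → refl) (λ _ → refl) is (false ∷ true ∷ []) vs)
           (relocate (Product.map (α ∘ inj₂) (α ∘ inj₂)) (Product.map β₁ β₁) (λ b → inj₁ b , inj₂ (t b)) (Product.map inj₂ inj₂)
             (λ _ → refl) (λ b → cong (α (inj₂ (inj₁ b)) ,_) (ter b)) (λ _ → refl) D (false ∷ true ∷ []) E) ⟩
    cnt ρ (map (α ∘ inj₂ ∘ inj₂) is ++ map β₁ vs₁) (mapE (α ∘ inj₂) D ++ mapE β₁ E₁)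
      ≡⟨ process H ρ (α ∘ inj₂) β₁ inj₁ vs₁ E₁ (λ e → inj₂-injective (inj e))
           (λ { i (inj₁ s) e → case inj e of λ () ; i (inj₂ y) → fresh (inj₂ i) y }) (λ _ → refl)
           (λ { false → here refl ; true → there (here refl) }) ⟩
    F * cnt σ vs₁ E₁ + unlessEq σ (inj₁ false) (inj₁ true) 0 (T * cnt (merge σ (inj₁ false) (inj₁ true)) vs₁ E₁)
      ≡⟨ cong₂ _+_ (cong (F *_) (spokes-separate σ t vs E tvs distinct fresh₁))
           (trans (unlessEq-no σ (inj₁ false) (inj₁ true) distinct)
             (cong (T *_) (spokes-joined σ t vs E tvs distinct fresh₁))) ⟩
    F * B + T * (2 * B + unlessEq (ρ ∘ β) a b 0 C)
      ≡⟨ collect (ρ ∘ β) a b B C ⟩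
    (F + 2 * T) * B + unlessEq (ρ ∘ β) a b 0 (T * C) ∎
  where
  open ≡-Reasoning
  open +-*-Solver
  collect : ∀ {Y : Set} (ρ : Y → ℕ) a b B C →
    F * B + T * (2 * B + unlessEq ρ a b 0 C) ≡ (F + 2 * T) * B + unlessEq ρ a b 0 (T * C)
  collect ρ a b B C with ρ a ≟ˡ ρ b
  ... | yes _ = solve 3 (λ F T B → F :* B :+ T :* (con 2 :* B :+ con 0) := (F :+ con 2 :* T) :* B :+ con 0) refl F T B
  ... | no _ = solve 4 (λ F T B C → F :* B :+ T :* (con 2 :* B :+ C) := (F :+ con 2 :* T) :* B :+ T :* C) refl F T B C

-- The count is the number of spanning trees

labels : (X → ℕ) → Edges X → X → ℕ
labels ρ [] = ρ
labels ρ ((a , b) ∷ S) = labels (merge ρ a b) S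

-- Acyclicity read along the list: each edge must join two classes at the moment it is contracted.
-- That the order is immaterial rests on `forest-swap`.
Forest : (X → ℕ) → Edges X → Set
Forest ρ [] = ⊤
Forest ρ ((a , b) ∷ S) = ρ a ≢ ρ b × Forest (merge ρ a b) S

labels-mono : ∀ (ρ : X → ℕ) S → ρ ⊑ labels ρ S
labels-mono ρ [] e = e
labels-mono ρ ((a , b) ∷ S) e = labels-mono (merge ρ a b) S (merge-mono ρ a b e)

labels-edge : ∀ (ρ : X → ℕ) {S a b} → (a , b) ∈ S → labels ρ S a ≡ labels ρ S b
labels-edge ρ {(a , b) ∷ S} (here refl) = labels-mono (merge ρ a b) S (merge-joins ρ a b)
labels-edge ρ {(a , b) ∷ S} (there p) = labels-edge (merge ρ a b) p

labels-least : ∀ {W : X → X → Set} → IsEquivalence W → ∀ (ρ : X → ℕ) S → (∀ {x y} → ρ x ≡ ρ y → W x y) →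
  (∀ {a b} → (a , b) ∈ S → W a b) → ∀ {x y} → labels ρ S x ≡ labels ρ S y → W x y
labels-least eq ρ [] inc edges e = inc e
labels-least eq ρ ((a , b) ∷ S) inc edges e =
  labels-least eq (merge ρ a b) S (merge-least eq ρ inc (edges (here refl))) (edges ∘ there) e

forest-⊑ : ∀ {ρ σ : X → ℕ} S → σ ⊑ ρ → Forest ρ S → Forest σ S
forest-⊑ [] le f = tt
forest-⊑ {ρ = ρ} {σ} ((a , b) ∷ S) le (ne , f) = (λ e → ne (le e)) , forest-⊑ {ρ = merge ρ a b} {merge σ a b} S (merge-⊑ {ρ = σ} {ρ} le a b) f

-- If contracting `(c , d)` joined `a` to `b`, then contracting `(a , b)` would already join `c` to
-- `d`. The rest of the list sees the same partition in either order.
forest-swap : ∀ (ρ : X → ℕ) {a b c d} S → Forest ρ ((a , b) ∷ (c , d) ∷ S) → Forest ρ ((c , d) ∷ (a , b) ∷ S)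
forest-swap ρ {a} {b} {c} {d} S (p , q , f) =
    (λ e → q (merge-mono ρ a b e))
  , (λ e → case merge-kernel ρ c d a b e of λ where
       (inj₁ h) → p h
       (inj₂ (inj₁ (h , k))) → q (trans (merge-mono ρ a b (sym h)) (trans (merge-joins ρ a b) (merge-mono ρ a b k)))
       (inj₂ (inj₂ (h , k))) → q (trans (merge-mono ρ a b (sym k)) (trans (sym (merge-joins ρ a b)) (merge-mono ρ a b h))))
  , forest-⊑ {ρ = labels ρ ((a , b) ∷ (c , d) ∷ [])} {labels ρ ((c , d) ∷ (a , b) ∷ [])} S
      (labels-least (kernel (labels ρ ((a , b) ∷ (c , d) ∷ []))) ρ ((c , d) ∷ (a , b) ∷ [])
        (labels-mono ρ ((a , b) ∷ (c , d) ∷ []))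
        (λ { (here refl) → labels-edge ρ {(a , b) ∷ (c , d) ∷ []} (there (here refl)) ; (there (here refl)) → labels-edge ρ {(a , b) ∷ (c , d) ∷ []} (here refl) })) f

-- Swaps carry the edge to the end of the list, where it must still join two classes.
forest-bridge : ∀ (ρ : X → ℕ) {a b} S → Forest ρ ((a , b) ∷ S) → labels ρ S a ≢ labels ρ S b
forest-bridge ρ [] (p , _) = p
forest-bridge ρ ((c , d) ∷ S) f = forest-bridge (merge ρ c d) S (proj₂ (forest-swap ρ S f))

forest-bridge-∈ : ∀ (ρ : X → ℕ) {a b} S → Forest ρ S → (p : (a , b) ∈ S) → labels ρ (S ─ p) a ≢ labels ρ (S ─ p) b
forest-bridge-∈ ρ (_ ∷ S) f (here refl) = forest-bridge ρ S f
forest-bridge-∈ ρ ((c , d) ∷ S) (_ , f) (there p) = forest-bridge-∈ (merge ρ c d) S f p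

∈-─ : ∀ {x z : X} {xs} (p : x ∈ xs) → z ∈ xs → z ≢ x → z ∈ (xs ─ p)
∈-─ (here refl) (here refl) n = ⊥-elim (n refl)
∈-─ (here refl) (there q) n = q
∈-─ (there p) (here refl) n = here refl
∈-─ (there p) (there q) n = there (∈-─ p q n)

sel : (E : List X) → Vec Bool (length E) → List X
sel [] [] = []
sel (e ∷ E) (true ∷ m) = e ∷ sel E m
sel (e ∷ E) (false ∷ m) = sel E m

sel-⊆ : ∀ {x : X} E m → x ∈ sel E m → x ∈ E
sel-⊆ [] [] ()
sel-⊆ (e ∷ E) (true ∷ m) (here refl) = here refl
sel-⊆ (e ∷ E) (true ∷ m) (there p) = there (sel-⊆ E m p)
sel-⊆ (e ∷ E) (false ∷ m) p = there (sel-⊆ E m p)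

sel-AllPairs : ∀ {R : X → X → Set} E m → AllPairs R E → AllPairs R (sel E m)
sel-AllPairs [] [] a = []
sel-AllPairs (e ∷ E) (true ∷ m) (r ∷ a) = All.tabulate (λ p → All.lookup r (sel-⊆ E m p)) ∷ sel-AllPairs E m a
sel-AllPairs (e ∷ E) (false ∷ m) (r ∷ a) = sel-AllPairs E m a

-- The recursion of `cnt` with sums replaced by concatenations, so that its length is the count by
-- construction. Subsets are encoded as masks to make repetitions impossible.
trees : (X → ℕ) → List X → (E : Edges X) → List (Vec Bool (length E))
trees ρ vs [] = if does (allEq? ρ vs) then [] ∷ [] else []
trees ρ vs ((a , b) ∷ E) = map (false ∷_) (trees ρ vs E) ++ unlessEq ρ a b [] (map (true ∷_) (trees (merge ρ a b) vs E))

length-trees : ∀ (ρ : X → ℕ) vs E → length (trees ρ vs E) ≡ cnt ρ vs E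
length-trees ρ vs [] with does (allEq? ρ vs)
... | true = refl
... | false = refl
length-trees ρ vs ((a , b) ∷ E) = trans (length-++ (map (false ∷_) (trees ρ vs E)))
  (cong₂ _+_ (trans (length-map (false ∷_) (trees ρ vs E)) (length-trees ρ vs E)) rest)
  where
  rest : length (unlessEq ρ a b [] (map (true ∷_) (trees (merge ρ a b) vs E))) ≡ unlessEq ρ a b 0 (cnt (merge ρ a b) vs E)
  rest with ρ a ≟ˡ ρ b
  ... | yes _ = refl
  ... | no _ = trans (length-map (true ∷_) (trees (merge ρ a b) vs E)) (length-trees (merge ρ a b) vs E)

trees-unique : ∀ (ρ : X → ℕ) vs E → Unique (trees ρ vs E)
trees-unique ρ vs [] with does (allEq? ρ vs)
... | true = [] ∷ []
... | false = []
trees-unique ρ vs ((a , b) ∷ E) = Unique.++⁺ (Unique.map⁺ ∷-injectiveʳ (trees-unique ρ vs E)) rest disjoint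
  where
  rest : Unique (unlessEq ρ a b [] (map (true ∷_) (trees (merge ρ a b) vs E)))
  rest with ρ a ≟ˡ ρ b
  ... | yes _ = []
  ... | no _ = Unique.map⁺ ∷-injectiveʳ (trees-unique (merge ρ a b) vs E)
  disjoint : ∀ {m} → m ∈ map (false ∷_) (trees ρ vs E) × m ∈ unlessEq ρ a b [] (map (true ∷_) (trees (merge ρ a b) vs E)) → ⊥
  disjoint (p , q) with ρ a ≟ˡ ρ b
  disjoint (p , ()) | yes _
  disjoint (p , q) | no _ with ∈-map⁻ (false ∷_) p | ∈-map⁻ (true ∷_) q
  ... | _ , _ , refl | _ , _ , ()

trees-sound : ∀ (ρ : X → ℕ) vs E {m} → m ∈ trees ρ vs E → Forest ρ (sel E m) × AllEq (labels ρ (sel E m)) vs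
trees-sound ρ vs [] {[]} p with allEq? ρ vs
... | yes h = tt , h
trees-sound ρ vs ((a , b) ∷ E) p with ∈-++⁻ (map (false ∷_) (trees ρ vs E)) p
... | inj₁ q with ∈-map⁻ (false ∷_) q
... | _ , r , refl = trees-sound ρ vs E r
trees-sound ρ vs ((a , b) ∷ E) p | inj₂ q with ρ a ≟ˡ ρ b
... | no n with ∈-map⁻ (true ∷_) q
... | _ , r , refl = let f , h = trees-sound (merge ρ a b) vs E r in (n , f) , h

trees-complete : ∀ (ρ : X → ℕ) vs E m → Forest ρ (sel E m) → AllEq (labels ρ (sel E m)) vs → m ∈ trees ρ vs E
trees-complete ρ vs [] [] f h with allEq? ρ vs
... | yes _ = here refl
... | no n = ⊥-elim (n h)
trees-complete ρ vs ((a , b) ∷ E) (false ∷ m) f h = ∈-++⁺ˡ (∈-map⁺ (false ∷_) (trees-complete ρ vs E m f h))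
trees-complete ρ vs ((a , b) ∷ E) (true ∷ m) (n , f) h = ∈-++⁺ʳ (map (false ∷_) (trees ρ vs E)) q
  where
  q : true ∷ m ∈ unlessEq ρ a b [] (map (true ∷_) (trees (merge ρ a b) vs E))
  q with ρ a ≟ˡ ρ b
  ... | yes e = ⊥-elim (n e)
  ... | no _ = ∈-map⁺ (true ∷_) (trees-complete (merge ρ a b) vs E m f h)

-- Spanning subgraphs as edge subsets

Same Distinct : X × X → X × X → Set
Same e f = e ≡ f ⊎ e ≡ swap f
Distinct e f = ¬ Same e f

SimpleEdges : Edges X → Set
SimpleEdges E = AllPairs Distinct E × All (λ (a , b) → a ≢ b) E

same-≡ : ∀ {E : Edges X} {e f} → AllPairs Distinct E → e ∈ E → f ∈ E → Same e f → e ≡ f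
same-≡ (r ∷ a) (here refl) (here refl) s = refl
same-≡ (r ∷ a) (here refl) (there q) s = ⊥-elim (All.lookup r q s)
same-≡ (r ∷ a) (there p) (here refl) (inj₁ s) = s
same-≡ (r ∷ a) (there p) (here refl) (inj₂ refl) = ⊥-elim (All.lookup r p (inj₂ refl))
same-≡ (r ∷ a) (there p) (there q) s = same-≡ a p q s

module _ {n : ℕ} where
  private
    V = Fin n

  Joined : Edges V → V → V → Set
  Joined S u v = (u , v) ∈ S ⊎ (v , u) ∈ S

  joined? : ∀ S u v → Dec (Joined S u v)
  joined? S u v = mem? (×-≡-dec _≟ᶠ_ _≟ᶠ_) (u , v) S ⊎-dec mem? (×-≡-dec _≟ᶠ_ _≟ᶠ_) (v , u) S

  graph : Edges V → Graph n
  graph S = tabulate λ u → tabulate λ v → does (joined? S u v)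

  lookup-graph : ∀ S u v → lookup (lookup (graph S) u) v ≡ does (joined? S u v)
  lookup-graph S u v = trans (cong (λ r → lookup r v) (lookup∘tabulate (λ u → tabulate λ v → does (joined? S u v)) u))
                             (lookup∘tabulate (λ v → does (joined? S u v)) v)

  adj⇒joined : ∀ S {u v} → Adj (graph S) u v → Joined S u v
  adj⇒joined S {u} {v} a = case joined? S u v of λ where
    (yes j) → j
    (no ¬j) → case trans (sym a) (trans (lookup-graph S u v) (dec-false (joined? S u v) ¬j)) of λ ()

  joined⇒adj : ∀ S {u v} → Joined S u v → Adj (graph S) u v
  joined⇒adj S {u} {v} j = trans (lookup-graph S u v) (dec-true (joined? S u v) j)

  graph-ext : (G H : Graph n) → (∀ {u v} → Adj G u v → Adj H u v) → (∀ {u v} → Adj H u v → Adj G u v) → G ≡ H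
  graph-ext G H f g = trans (sym (tabulate∘lookup G)) (trans (tabulate-cong λ u →
      trans (sym (tabulate∘lookup (lookup G u))) (trans (tabulate-cong λ v → bool f g) (tabulate∘lookup (lookup H u))))
    (tabulate∘lookup H))
    where
    bool : ∀ {a b : Bool} → (a ≡ true → b ≡ true) → (b ≡ true → a ≡ true) → a ≡ b
    bool {true} {b} f g = sym (f refl)
    bool {false} {true} f g = g refl
    bool {false} {false} f g = refl

  graph-simple : ∀ S → All (λ (a , b) → a ≢ b) S → IsSimple (graph S)
  graph-simple S loopless =
      (λ u v → trans (lookup-graph S u v) (trans (does-cong (joined? S u v) (joined? S v u) Sum.swap Sum.swap) (sym (lookup-graph S v u))))
    , (λ u → trans (lookup-graph S u u) (dec-false (joined? S u u) λ { (inj₁ p) → All.lookup loopless p refl ; (inj₂ p) → All.lookup loopless p refl }))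

  mask : Graph n → (E : Edges V) → Vec Bool (length E)
  mask H [] = []
  mask H ((a , b) ∷ E) = lookup (lookup H a) b ∷ mask H E

  mask-sel : ∀ H E m → AllPairs Distinct E → (∀ {a b} → (a , b) ∈ E → Adj H a b → (a , b) ∈ sel E m) →
    (∀ {a b} → (a , b) ∈ sel E m → Adj H a b) → mask H E ≡ m
  mask-sel H [] [] _ f g = refl
  mask-sel H ((a , b) ∷ E) (c ∷ m) (r ∷ d) f g = cong₂ _∷_ (bit c f g) (mask-sel H E m d (f' c f) (g' c g))
    where
    absent : ∀ {x} → x ∈ E → x ≢ (a , b)
    absent p refl = All.lookup r p (inj₁ refl)
    bit : ∀ c → (∀ {x y} → (x , y) ∈ (a , b) ∷ E → Adj H x y → (x , y) ∈ sel ((a , b) ∷ E) (c ∷ m)) →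
      (∀ {x y} → (x , y) ∈ sel ((a , b) ∷ E) (c ∷ m) → Adj H x y) → lookup (lookup H a) b ≡ c
    bit true f g = g (here refl)
    bit false f g with lookup (lookup H a) b in eq
    ... | false = refl
    ... | true = ⊥-elim (absent (sel-⊆ E m (f (here refl) eq)) refl)
    f' : ∀ c → (∀ {x y} → (x , y) ∈ (a , b) ∷ E → Adj H x y → (x , y) ∈ sel ((a , b) ∷ E) (c ∷ m)) →
      ∀ {x y} → (x , y) ∈ E → Adj H x y → (x , y) ∈ sel E m
    f' true f p h with f (there p) h
    ... | here refl = ⊥-elim (absent p refl)
    ... | there q = q
    f' false f p h = f (there p) h
    g' : ∀ c → (∀ {x y} → (x , y) ∈ sel ((a , b) ∷ E) (c ∷ m) → Adj H x y) → ∀ {x y} → (x , y) ∈ sel E m → Adj H x y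
    g' true g p = g (there p)
    g' false g p = g p

  -- Adjacency cannot tell apart two entries of the list with the same two ends, in whatever order;
  -- distinctness of unordered pairs is what makes the mask recoverable.
  mask-graph : ∀ E → AllPairs Distinct E → ∀ m → mask (graph (sel E m)) E ≡ m
  mask-graph E d m = mask-sel (graph (sel E m)) E m d from (joined⇒adj (sel E m) ∘ inj₁)
    where
    from : ∀ {a b} → (a , b) ∈ E → Adj (graph (sel E m)) a b → (a , b) ∈ sel E m
    from p h with adj⇒joined (sel E m) h
    ... | inj₁ q = q
    ... | inj₂ q = subst (_∈ sel E m) (sym (same-≡ d p (sel-⊆ E m q) (inj₂ refl))) q

  sel-mask⁻ : ∀ H E {a b} → (a , b) ∈ sel E (mask H E) → Adj H a b
  sel-mask⁻ H ((c , d) ∷ E) p with lookup (lookup H c) d in eq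
  sel-mask⁻ H ((c , d) ∷ E) (here refl) | true = eq
  sel-mask⁻ H ((c , d) ∷ E) (there p) | true = sel-mask⁻ H E p
  sel-mask⁻ H ((c , d) ∷ E) p | false = sel-mask⁻ H E p

  sel-mask⁺ : ∀ H E {a b} → (a , b) ∈ E → Adj H a b → (a , b) ∈ sel E (mask H E)
  sel-mask⁺ H ((c , d) ∷ E) p h with lookup (lookup H c) d in eq
  sel-mask⁺ H ((c , d) ∷ E) (here refl) h | true = here refl
  sel-mask⁺ H ((c , d) ∷ E) (there p) h | true = there (sel-mask⁺ H E p h)
  sel-mask⁺ H ((c , d) ∷ E) (here refl) h | false = case trans (sym h) eq of λ ()
  sel-mask⁺ H ((c , d) ∷ E) (there p) h | false = sel-mask⁺ H E p h

  graph-mask : ∀ E H → H ⊆G graph E → IsSimple H → graph (sel E (mask H E)) ≡ H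
  graph-mask E H sub (symm , _) = graph-ext _ H
    (λ a → case adj⇒joined (sel E (mask H E)) a of λ where
       (inj₁ p) → sel-mask⁻ H E p
       (inj₂ p) → trans (symm _ _) (sel-mask⁻ H E p))
    (λ {u} {v} h → joined⇒adj (sel E (mask H E)) (case adj⇒joined E (sub u v h) of λ where
       (inj₁ p) → inj₁ (sel-mask⁺ H E p h)
       (inj₂ p) → inj₂ (sel-mask⁺ H E p (trans (symm v u) h))))

  walk-trans : ∀ {G : Graph n} {u v w} → Walk G u v → Walk G v w → Walk G u w
  walk-trans here q = q
  walk-trans (step a p) q = step a (walk-trans p q)

  walk-equivalence : ∀ S → IsEquivalence (Walk (graph S))
  walk-equivalence S = record { refl = here ; sym = walk-sym ; trans = walk-trans }
    where
    walk-sym : ∀ {u v} → Walk (graph S) u v → Walk (graph S) v u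
    walk-sym here = here
    walk-sym (step a p) = walk-trans (walk-sym p) (step (joined⇒adj S (Sum.swap (adj⇒joined S a))) here)

  walk⇒labels : ∀ (ρ : V → ℕ) S {u v} → Walk (graph S) u v → labels ρ S u ≡ labels ρ S v
  walk⇒labels ρ S here = refl
  walk⇒labels ρ S (step a p) = trans (Sum.[ labels-edge ρ , (λ q → sym (labels-edge ρ q)) ] (adj⇒joined S a)) (walk⇒labels ρ S p)

  labels⇒walk : ∀ S {u v} → labels toℕ S u ≡ labels toℕ S v → Walk (graph S) u v
  labels⇒walk S = labels-least (walk-equivalence S) toℕ S (λ e → subst (Walk (graph S) _) (toℕ-injective e) here)
    (λ p → step (joined⇒adj S (inj₁ p)) here)

  -- Delete the closing edge of a cycle from the list: the other edges of the cycle still connect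
  -- its ends, although in a forest every edge is a bridge.
  forest⇒acyclic : ∀ S → Forest toℕ S → Acyclic (graph S)
  forest⇒acyclic S fo (l , f , inj , adj , close) = case adj⇒joined S close of λ where
      (inj₁ p) → forest-bridge-∈ toℕ S fo p (sym (around p
        (λ i e → fromℕ≢inject₁ (sym (inj (cong proj₁ e))))
        -- The second vertex of the cycle is not the last one, since a cycle has at least three
        -- vertices; this excludes the closing edge traversed backwards.
        (λ { zero e → case inj (cong proj₁ e) of λ () ; (suc i) e → case inj (cong proj₂ e) of λ () })))
      (inj₂ p) → forest-bridge-∈ toℕ S fo p (around p
        (λ { zero e → case inj (cong proj₂ e) of λ () ; (suc i) e → case inj (cong proj₁ e) of λ () })
        (λ i e → case inj (cong proj₁ e) of λ ()))
    where
    chain : ∀ {m} (g : Fin (suc m) → ℕ) → (∀ (i : Fin m) → g (inject₁ i) ≡ g (suc i)) → g zero ≡ g (fromℕ m)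
    chain {zero} g h = refl
    chain {suc m} g h = trans (h zero) (chain (g ∘ suc) (h ∘ suc))
    around : ∀ {e} (p : e ∈ S) → (∀ i → (f (inject₁ i) , f (suc i)) ≢ e) → (∀ i → (f (suc i) , f (inject₁ i)) ≢ e) →
      labels toℕ (S ─ p) (f zero) ≡ labels toℕ (S ─ p) (f (fromℕ (suc (suc l))))
    around p n n' = chain (labels toℕ (S ─ p) ∘ f) λ i → case adj⇒joined S (adj i) of λ where
      (inj₁ q) → labels-edge toℕ (∈-─ p q (n i))
      (inj₂ q) → sym (labels-edge toℕ (∈-─ p q (n' i)))

  SimplePath : Graph n → V → V → Set
  SimplePath G u v = Σ ℕ λ m → Σ (Fin (suc m) → V) λ f →
    f zero ≡ u × f (fromℕ m) ≡ v × Injective _≡_ _≡_ f × (∀ i → Adj G (f (inject₁ i)) (f (suc i)))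

  -- Loop erasure: if the new starting vertex already lies on the path, keep only the part from
  -- there on.
  walk⇒path : ∀ {G : Graph n} {u v} → Walk G u v → SimplePath G u v
  walk⇒path {u = u} here = 0 , (λ _ → u) , refl , refl , (λ { {zero} {zero} _ → refl }) , λ ()
  walk⇒path {G} {u} {v} (step a w) with walk⇒path w
  ... | m , f , refl , refl , inj , adj with any? (λ i → f i ≟ᶠ u)
  ... | yes (i , refl) = suffix f inj adj i
    where
    suffix : ∀ {m} (f : Fin (suc m) → V) → Injective _≡_ _≡_ f → (∀ i → Adj G (f (inject₁ i)) (f (suc i))) →
      ∀ i → SimplePath G (f i) (f (fromℕ m))
    suffix f inj adj zero = _ , f , refl , refl , inj , adj
    suffix {suc m} f inj adj (suc i) = suffix (f ∘ suc) (Fin-suc-injective ∘ inj) (adj ∘ suc) i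
  ... | no ∉ = suc m , g , refl , refl , g-inj , λ { zero → a ; (suc i) → adj i }
    where
    g : Fin (suc (suc m)) → V
    g zero = u
    g (suc i) = f i
    g-inj : Injective _≡_ _≡_ g
    g-inj {zero} {zero} e = refl
    g-inj {zero} {suc j} e = ⊥-elim (∉ (j , sym e))
    g-inj {suc i} {zero} e = ⊥-elim (∉ (i , e))
    g-inj {suc i} {suc j} e = cong suc (inj e)

  -- `P` holds the edges contracted so far, and equal labels are witnessed by walks in `P`. If the
  -- next edge had equally labelled ends, a simple path in `P` would close up with it to a cycle;
  -- paths with fewer than two edges are excluded because the edges are loopless and distinct.
  acyclic⇒forest : ∀ S₀ → Acyclic (graph S₀) → ∀ S P (ρ : V → ℕ) → (∀ {x y} → ρ x ≡ ρ y → Walk (graph P) x y) →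
    (∀ {e} → e ∈ P → e ∈ S₀) → (∀ {e} → e ∈ S → e ∈ S₀) → (∀ {e f} → e ∈ S → f ∈ P → Distinct e f) →
    SimpleEdges S → Forest ρ S
  acyclic⇒forest S₀ ac [] P ρ reach P⊆ S⊆ apart simple = tt
  acyclic⇒forest S₀ ac ((a , b) ∷ S) P ρ reach P⊆ S⊆ apart (r ∷ d , a≢b ∷ loopless) =
      (λ e → closing (walk⇒path (reach e)))
    , acyclic⇒forest S₀ ac S ((a , b) ∷ P) (merge ρ a b)
        (merge-least (walk-equivalence ((a , b) ∷ P)) ρ (λ e → weaken (reach e)) (step (joined⇒adj ((a , b) ∷ P) (inj₁ (here refl))) here))
        (λ { (here refl) → S⊆ (here refl) ; (there p) → P⊆ p }) (S⊆ ∘ there)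
        (λ { p (here refl) s → All.lookup r p (Sum.map sym (λ { refl → refl }) s) ; p (there q) → apart (there p) q }) (d , loopless)
    where
    weaken : ∀ {x y} → Walk (graph P) x y → Walk (graph ((a , b) ∷ P)) x y
    weaken here = here
    weaken (step h w) = step (joined⇒adj ((a , b) ∷ P) (Sum.map there there (adj⇒joined P h))) (weaken w)
    closing : SimplePath (graph P) a b → ⊥
    closing (zero , f , refl , refl , inj , adj) = a≢b refl
    closing (suc zero , f , refl , refl , inj , adj) with adj⇒joined P (adj zero)
    ... | inj₁ p = apart (here refl) p (inj₁ refl)
    ... | inj₂ p = apart (here refl) p (inj₂ refl)
    closing (suc (suc l) , f , refl , refl , inj , adj) = ac (l , f , inj
      , (λ i → joined⇒adj S₀ (Sum.map P⊆ P⊆ (adj⇒joined P (adj i)))) , joined⇒adj S₀ (inj₂ (S⊆ (here refl))))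

  hasTau : ∀ {E vs} → SimpleEdges E → (∀ v → v ∈ vs) → HasTau (graph E) (cnt toℕ vs E)
  hasTau {E} {vs} (distinct , loopless) all =
      map (graph ∘ sel E) (trees toℕ vs E)
    , Unique.map⁺ (λ {x} {y} e → trans (sym (mask-graph E distinct x)) (trans (cong (λ H → mask H E) e) (mask-graph E distinct y)))
        (trees-unique toℕ vs E)
    , trans (length-map (graph ∘ sel E) (trees toℕ vs E)) (length-trees toℕ vs E)
    , λ H → mk⇔ to (from H)
    where
    loopless-sel : ∀ m → All (λ (a , b) → a ≢ b) (sel E m)
    loopless-sel m = All.tabulate (λ p → All.lookup loopless (sel-⊆ E m p))
    to : ∀ {H} → H ∈ map (graph ∘ sel E) (trees toℕ vs E) → IsSpanningTree (graph E) H
    to p with ∈-map⁻ (graph ∘ sel E) p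
    ... | m , q , refl = let f , h = trees-sound toℕ vs E q in
        (λ u v a → joined⇒adj E (Sum.map (sel-⊆ E m) (sel-⊆ E m) (adj⇒joined (sel E m) a)))
      , graph-simple (sel E m) (loopless-sel m)
      , (λ u v → labels⇒walk (sel E m) (h (all u) (all v)))
      , forest⇒acyclic (sel E m) f
    from : ∀ H → IsSpanningTree (graph E) H → H ∈ map (graph ∘ sel E) (trees toℕ vs E)
    from H (sub , simple , conn , acyc) = subst (_∈ map (graph ∘ sel E) (trees toℕ vs E)) eq
      (∈-map⁺ (graph ∘ sel E) (trees-complete toℕ vs E m
        (acyclic⇒forest S (subst Acyclic (sym eq) acyc) S [] toℕ (λ e → subst (Walk _ _) (toℕ-injective e) here) (λ ()) id (λ _ ())
          (sel-AllPairs E m distinct , loopless-sel m))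
        (λ {x} {y} _ _ → walk⇒labels toℕ S (subst (λ G → Walk G x y) (sym eq) (conn x y)))))
      where
      m = mask H E
      S = sel E m
      eq : graph S ≡ H
      eq = graph-mask E H sub simple

  -- Turns a positive tree count into connectedness, so that no walks in the constructed graphs have
  -- to be exhibited.
  tau-connected : ∀ {G : Graph n} {t} → HasTau G (suc t) → Connected G
  tau-connected (H ∷ _ , _ , _ , char) u v = lift (conn u v)
    where
    spanning = Equivalence.to (char H) (here refl)
    conn = proj₁ (proj₂ (proj₂ spanning))
    lift : ∀ {u v} → Walk H u v → Walk _ u v
    lift here = here
    lift (step a w) = step (proj₁ spanning _ _ a) (lift w)

-- Degrees and simplicity

ind : DecidableEquality X → X → X → ℕ
ind _≟_ x y = if does (x ≟ y) then 1 else 0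

ind-yes : ∀ (_≟_ : DecidableEquality X) {x y} → x ≡ y → ind _≟_ x y ≡ 1
ind-yes _≟_ {x} {y} e = cong (if_then 1 else 0) (dec-true (x ≟ y) e)

ind-no : ∀ (_≟_ : DecidableEquality X) {x y} → x ≢ y → ind _≟_ x y ≡ 0
ind-no _≟_ {x} {y} e = cong (if_then 1 else 0) (dec-false (x ≟ y) e)

deg : DecidableEquality X → Edges X → X → ℕ
deg _≟_ [] x = 0
deg _≟_ ((a , b) ∷ E) x = ind _≟_ a x + ind _≟_ b x + deg _≟_ E x

module _ (_≟_ : DecidableEquality X) where

  deg-++ : ∀ D E x → deg _≟_ (D ++ E) x ≡ deg _≟_ D x + deg _≟_ E x
  deg-++ [] E x = refl
  deg-++ ((a , b) ∷ D) E x = trans (cong (ind _≟_ a x + ind _≟_ b x +_) (deg-++ D E x)) (sym (+-assoc (ind _≟_ a x + ind _≟_ b x) _ _))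

  deg-absent : ∀ {x} E → (∀ {a b} → (a , b) ∈ E → a ≢ x × b ≢ x) → deg _≟_ E x ≡ 0
  deg-absent [] h = refl
  deg-absent ((a , b) ∷ E) h = cong₂ _+_ (cong₂ _+_ (ind-no _≟_ (proj₁ (h (here refl)))) (ind-no _≟_ (proj₂ (h (here refl)))))
    (deg-absent E (h ∘ there))

  deg-outside : ∀ (f : Y → X) {x} D → (∀ y → f y ≢ x) → deg _≟_ (mapE f D) x ≡ 0
  deg-outside f D h = deg-absent (mapE f D) λ p → case ∈-map⁻ (Product.map f f) p of λ { ((a , b) , _ , refl) → h a , h b }

  deg-map : ∀ (_≟′_ : DecidableEquality Y) (f : Y → X) → Injective _≡_ _≡_ f → ∀ D y → deg _≟_ (mapE f D) (f y) ≡ deg _≟′_ D y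
  deg-map _≟′_ f inj [] y = refl
  deg-map _≟′_ f inj ((a , b) ∷ D) y = cong₂ _+_ (cong₂ _+_ (same a) (same b)) (deg-map _≟′_ f inj D y)
    where
    same : ∀ a → ind _≟_ (f a) (f y) ≡ ind _≟′_ a y
    same a = cong (if_then 1 else 0) (does-cong (f a ≟ f y) (a ≟′ y) inj (cong f))

star : X → List X → Edges X
star x = map (x ,_)

complete : List X → Edges X
complete [] = []
complete (x ∷ xs) = star x xs ++ complete xs

complete-∈ : ∀ (xs : List X) {a b} → (a , b) ∈ complete xs → a ∈ xs × b ∈ xs
complete-∈ (x ∷ xs) p with ∈-++⁻ (star x xs) p
... | inj₁ q with ∈-map⁻ (x ,_) q
... | _ , r , refl = here refl , there r
complete-∈ (x ∷ xs) p | inj₂ q = Product.map there there (complete-∈ xs q)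

-- Edges point from earlier to later vertices, so none ends at the head. This serves to show that
-- every edge of `box` has an inner end.
complete-∈ʳ : ∀ x (xs : List X) {a b} → (a , b) ∈ complete (x ∷ xs) → b ∈ xs
complete-∈ʳ x xs p with ∈-++⁻ (star x xs) p
... | inj₁ q with ∈-map⁻ (x ,_) q
... | _ , r , refl = r
complete-∈ʳ x xs p | inj₂ q = proj₂ (complete-∈ xs q)

module _ (_≟_ : DecidableEquality X) where

  deg-star-centre : ∀ {x} xs → All (x ≢_) xs → deg _≟_ (star x xs) x ≡ length xs
  deg-star-centre [] [] = refl
  deg-star-centre {x} (y ∷ xs) (ne ∷ h) =
    cong₂ _+_ (cong₂ _+_ (ind-yes _≟_ {x} refl) (ind-no _≟_ (ne ∘ sym))) (deg-star-centre xs h)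

  deg-star-leaf : ∀ {x y} xs → x ≢ y → Unique xs → y ∈ xs → deg _≟_ (star x xs) y ≡ 1
  deg-star-leaf {x} {y} (y ∷ xs) n (h ∷ u) (here refl) = cong₂ _+_ (cong₂ _+_ (ind-no _≟_ n) (ind-yes _≟_ {y} refl))
    (deg-absent _≟_ (star x xs) λ p → case ∈-map⁻ (x ,_) p of λ { (_ , q , refl) → n , λ e → All.lookup h q (sym e) })
  deg-star-leaf {x} {y} (z ∷ xs) n (h ∷ u) (there p) = cong₂ _+_ (cong₂ _+_ (ind-no _≟_ n) (ind-no _≟_ (All.lookup h p)))
    (deg-star-leaf xs n u p)

  deg-complete : ∀ {x} xs → Unique xs → x ∈ xs → suc (deg _≟_ (complete xs) x) ≡ length xs
  deg-complete {x} (x ∷ xs) (h ∷ u) (here refl) = cong suc (trans (deg-++ _≟_ (star x xs) (complete xs) x)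
    (trans (cong₂ _+_ (deg-star-centre xs h) (deg-absent _≟_ (complete xs) λ p → let q , r = complete-∈ xs p in
      (λ e → All.lookup h q (sym e)) , λ e → All.lookup h r (sym e))) (+-identityʳ _)))
  deg-complete {x} (y ∷ xs) (h ∷ u) (there p) = cong suc (trans (deg-++ _≟_ (star y xs) (complete xs) x)
    (trans (cong (_+ _) (deg-star-leaf xs (All.lookup h p) u p)) (deg-complete xs u p)))

complete-simple : ∀ (xs : List X) → Unique xs → SimpleEdges (complete xs)
complete-simple [] _ = [] , []
complete-simple (x ∷ xs) (h ∷ u) =
    AllPairs.++⁺ (star-distinct xs h u) (proj₁ (complete-simple xs u))
      (All.tabulate λ p → All.tabulate λ q s → case ∈-map⁻ (x ,_) p of λ where
        (_ , r , refl) → case s of λ where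
          (inj₁ refl) → All.lookup h (proj₁ (complete-∈ xs q)) refl
          (inj₂ refl) → All.lookup h (proj₂ (complete-∈ xs q)) refl)
  , All.++⁺ (All.map⁺ h) (proj₂ (complete-simple xs u))
  where
  star-distinct : ∀ xs → All (x ≢_) xs → Unique xs → AllPairs Distinct (star x xs)
  star-distinct [] _ _ = []
  star-distinct (y ∷ xs) (ne ∷ h) (g ∷ u) = All.map⁺ (All.tabulate λ p s → case s of λ where
      (inj₁ refl) → All.lookup g p refl
      (inj₂ refl) → ne refl) ∷ star-distinct xs h u

map-simple : ∀ {f : X → Y} → Injective _≡_ _≡_ f → ∀ {E} → SimpleEdges E → SimpleEdges (mapE f E)
map-simple {f = f} inj (d , l) = AllPairs.map⁺ (AllPairs.map (λ n s → n (unmap s)) d) , All.map⁺ (All.map (λ n e → n (inj e)) l)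
  where
  unmap : ∀ {e e'} → Same (Product.map f f e) (Product.map f f e') → Same e e'
  unmap (inj₁ e) = inj₁ (cong₂ _,_ (inj (cong proj₁ e)) (inj (cong proj₂ e)))
  unmap (inj₂ e) = inj₂ (cong₂ _,_ (inj (cong proj₁ e)) (inj (cong proj₂ e)))

++-simple : ∀ {D E : Edges X} → SimpleEdges D → SimpleEdges E → (∀ {e f} → e ∈ D → f ∈ E → Distinct e f) → SimpleEdges (D ++ E)
++-simple (d , l) (d' , l') h = AllPairs.++⁺ d d' (All.tabulate λ p → All.tabulate λ q → h p q) , All.++⁺ l l'

trues-flip : ∀ {m} (f g : Fin m → Bool) w → f w ≡ true → g w ≡ false → (∀ v → v ≢ w → f v ≡ g v) →
  trues (tabulate f) ≡ suc (trues (tabulate g))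
trues-flip f g zero ft gf h rewrite ft | gf = cong (suc ∘ trues) (tabulate-cong λ v → h (suc v) λ ())
trues-flip f g (suc w) ft gf h with trues-flip (f ∘ suc) (g ∘ suc) w ft gf (λ v n → h (suc v) (n ∘ Fin-suc-injective))
... | ih rewrite h zero (λ ()) with g zero
... | true = cong suc ih
... | false = ih

-- By simplicity, adding an edge at `u` flips exactly one entry of row `u`, the one at the other
-- end.
degree-graph : ∀ {n} (E : Edges (Fin n)) → SimpleEdges E → ∀ u → degree (graph E) u ≡ deg _≟ᶠ_ E u
degree-graph {n} E₀ simple₀ u = trans (cong trues (lookup∘tabulate (λ u → tabulate λ v → does (joined? E₀ u v)) u)) (go E₀ simple₀)
  where
  row : Edges (Fin n) → Fin n → Bool
  row E v = does (joined? E u v)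
  same : ∀ a b E v → (Joined ((a , b) ∷ E) u v → Joined E u v) → row ((a , b) ∷ E) v ≡ row E v
  same a b E v f = does-cong (joined? ((a , b) ∷ E) u v) (joined? E u v) f (Sum.map there there)
  go : ∀ E → SimpleEdges E → trues (tabulate (row E)) ≡ deg _≟ᶠ_ E u
  go [] _ = none n
    where
    none : ∀ m → trues (tabulate {n = m} (λ _ → false)) ≡ 0
    none zero = refl
    none (suc m) = none m
  go ((a , b) ∷ E) (r ∷ d , a≢b ∷ l) with a ≟ᶠ u | b ≟ᶠ u
  ... | yes refl | yes refl = ⊥-elim (a≢b refl)
  ... | yes refl | no _ = trans (trues-flip (row ((a , b) ∷ E)) (row E) b
          (dec-true (joined? ((a , b) ∷ E) a b) (inj₁ (here refl)))
          (dec-false (joined? E a b) λ { (inj₁ p) → All.lookup r p (inj₁ refl) ; (inj₂ p) → All.lookup r p (inj₂ refl) })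
          (λ v n → same a b E v λ { (inj₁ (here refl)) → ⊥-elim (n refl) ; (inj₁ (there p)) → inj₁ p
                          ; (inj₂ (here refl)) → ⊥-elim (a≢b refl) ; (inj₂ (there p)) → inj₂ p }))
        (cong suc (go E (d , l)))
  ... | no _ | yes refl = trans (trues-flip (row ((a , b) ∷ E)) (row E) a
          (dec-true (joined? ((a , b) ∷ E) b a) (inj₂ (here refl)))
          (dec-false (joined? E b a) λ { (inj₁ p) → All.lookup r p (inj₂ refl) ; (inj₂ p) → All.lookup r p (inj₁ refl) })
          (λ v n → same a b E v λ { (inj₁ (here refl)) → ⊥-elim (a≢b refl) ; (inj₁ (there p)) → inj₁ p
                          ; (inj₂ (here refl)) → ⊥-elim (n refl) ; (inj₂ (there p)) → inj₂ p }))
        (cong suc (go E (d , l)))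
  ... | no a≢u | no b≢u = trans (cong trues (tabulate-cong λ v → same a b E v λ
          { (inj₁ (here refl)) → ⊥-elim (a≢u refl) ; (inj₁ (there p)) → inj₁ p
          ; (inj₂ (here refl)) → ⊥-elim (b≢u refl) ; (inj₂ (there p)) → inj₂ p })) (go E (d , l))

-- Follow one branch greedily: contract an edge if it joins two classes, and delete it otherwise,
-- which loses no connection.
cnt-positive : ∀ (ρ : X → ℕ) vs E → AllEq (labels ρ E) vs → 1 ≤ cnt ρ vs E
cnt-positive ρ vs [] h with allEq? ρ vs
... | yes _ = s≤s z≤n
... | no n = ⊥-elim (n h)
cnt-positive ρ vs ((a , b) ∷ E) h with ρ a ≟ˡ ρ b
... | yes e = ≤-trans (cnt-positive ρ vs E λ p q → labels-least (kernel (labels ρ E)) (merge ρ a b) E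
    (λ e' → labels-mono ρ E (merge-least (kernel ρ) ρ id e e')) (labels-edge ρ) (h p q)) (m≤m+n _ _)
... | no _ = ≤-trans (cnt-positive (merge ρ a b) vs E h) (m≤n+m _ _)

-- Regular networks

private variable
  p q : Bool
  d e : ℕ

-- Networks whose internal vertices have degree 3 + k and whose terminals have degree d; in Net true d
-- the terminals are not adjacent.
module Networks (k : ℕ) where

  data Net : Bool → ℕ → Set where
    box : Net true (2 + k)
    edge : Net false 1
    -- The pendant edge raises the old terminals to degree `3 + k`, so that they can become
    -- internal.
    ext : Net p (2 + k) → Net true 1
    -- At most the first factor may have adjacent terminals; otherwise a double edge could arise.
    par : Net p d → Net true e → Net p (d + e)

  Inner : Net p d → Set
  Inner box = Fin (2 + k)
  Inner edge = ⊥
  Inner (ext N) = Bool ⊎ Inner N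
  Inner (par N M) = Inner N ⊎ Inner M

  Vertex : Net p d → Set
  Vertex N = Bool ⊎ Inner N

  inner : (N : Net p d) → List (Inner N)
  inner box = allFin (2 + k)
  inner edge = []
  inner (ext N) = map inj₂ (inner N) ++ map inj₁ (false ∷ true ∷ [])
  inner (par N M) = map inj₁ (inner N) ++ map inj₂ (inner M)

  boxInner : List (Bool ⊎ Fin (2 + k))
  boxInner = map inj₂ (allFin (2 + k))

  -- The complete graph on 4 + k vertices without the edge joining the terminals.
  boxEdges : Edges (Bool ⊎ Fin (2 + k))
  boxEdges = star (inj₁ false) boxInner ++ complete (inj₁ true ∷ boxInner)

  edges : (N : Net p d) → Edges (Vertex N)
  edges box = boxEdges
  edges edge = (inj₁ false , inj₁ true) ∷ []
  edges (ext N) = extension (edges N)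
  edges (par N M) = parallel (edges N) (edges M)

  size : Net p d → ℕ
  size box = 2 + k
  size edge = 0
  size (ext N) = 2 + size N
  size (par N M) = size N + size M

  inner↔ : (N : Net p d) → Inner N ↔ Fin (size N)
  inner↔ box = ↔-refl
  inner↔ edge = ↔-sym 0↔⊥
  inner↔ (ext N) = ↔-trans (↔-sym 2↔Bool ⊎-↔ inner↔ N) (↔-sym +↔⊎)
  inner↔ (par N M) = ↔-trans (inner↔ N ⊎-↔ inner↔ M) (↔-sym +↔⊎)

  vertex↔ : (N : Net p d) → Vertex N ↔ Fin (2 + size N)
  vertex↔ N = ↔-trans (↔-sym 2↔Bool ⊎-↔ inner↔ N) (↔-sym +↔⊎)

  inner-complete : (N : Net p d) (i : Inner N) → i ∈ inner N
  inner-complete box i = ∈-allFin i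
  inner-complete (ext N) (inj₁ false) = ∈-++⁺ʳ (map inj₂ (inner N)) (here refl)
  inner-complete (ext N) (inj₁ true) = ∈-++⁺ʳ (map inj₂ (inner N)) (there (here refl))
  inner-complete (ext N) (inj₂ i) = ∈-++⁺ˡ (∈-map⁺ inj₂ (inner-complete N i))
  inner-complete (par N M) (inj₁ i) = ∈-++⁺ˡ (∈-map⁺ inj₁ (inner-complete N i))
  inner-complete (par N M) (inj₂ i) = ∈-++⁺ʳ (map inj₁ (inner N)) (∈-map⁺ inj₂ (inner-complete M i))

  abstract
    -- The two numbers remain unknown: later arguments need them only to be positive.
    boxTransfer : ∃₂ λ T F → Transfer (allFin (2 + k)) boxEdges T F
    boxTransfer = transfer _≟ᶠ_ (allFin (2 + k)) boxEdges

  boxT boxF : ℕ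
  boxT = proj₁ boxTransfer
  boxF = proj₁ (proj₂ boxTransfer)

  T F : Net p d → ℕ
  T box = boxT
  T edge = 1
  T (ext N) = T N
  T (par N M) = T N * F M + F N * T M
  F box = boxF
  F edge = 1
  F (ext N) = F N + 2 * T N
  F (par N M) = F N * F M

  net-transfer : (N : Net p d) → Transfer (inner N) (edges N) (T N) (F N)
  net-transfer box = proj₂ (proj₂ boxTransfer)
  net-transfer edge = transfer-edge
  net-transfer (ext N) = transfer-extension (net-transfer N)
  net-transfer (par N M) = transfer-parallel (net-transfer N) (net-transfer M)

  module _ (ρ : Bool ⊎ Fin (2 + k) → ℕ) (inj : ∀ {i j} → ρ (inj₂ i) ≡ ρ (inj₂ j) → i ≡ j)
           (fresh : ∀ i b → ρ (inj₂ i) ≢ ρ (inj₁ b)) where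
    private
      D = mapE id boxEdges ++ mapE inj₁ []
      vs = map inj₂ (allFin (2 + k)) ++ map inj₁ (false ∷ true ∷ [])

      spoke-∈ : ∀ b i → (inj₁ b , inj₂ i) ∈ D
      spoke-∈ b i = ∈-++⁺ˡ (∈-map⁺ (Product.map id id) (at b))
        where
        at : ∀ b → (inj₁ b , inj₂ i) ∈ boxEdges
        at false = ∈-++⁺ˡ (∈-map⁺ (inj₁ false ,_) (∈-map⁺ inj₂ (∈-allFin i)))
        at true = ∈-++⁺ʳ (star (inj₁ false) boxInner) (∈-++⁺ˡ (∈-map⁺ (inj₁ true ,_) (∈-map⁺ inj₂ (∈-allFin i))))

      box-connected : ∀ x → labels ρ D x ≡ labels ρ D (inj₂ zero)
      box-connected (inj₁ b) = labels-edge ρ (spoke-∈ b zero)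
      box-connected (inj₂ i) = trans (sym (labels-edge ρ (spoke-∈ false i))) (box-connected (inj₁ false))

    -- The box alone is connected, so the law applied to edgeless surroundings has a positive value.
    -- Two choices of terminal labels then isolate `boxT` and `boxF`.
    box-count : 1 ≤ boxF * cnt (ρ ∘ inj₁) (false ∷ true ∷ []) []
      + unlessEq (ρ ∘ inj₁) false true 0 (boxT * cnt (merge (ρ ∘ inj₁) false true) (false ∷ true ∷ []) [])
    box-count = subst (1 ≤_) (process (net-transfer box) ρ id inj₁ id (false ∷ true ∷ []) [] inj fresh (λ _ → refl)
        (λ { false → here refl ; true → there (here refl) }))
      (cnt-positive ρ vs D λ {x} {y} _ _ → trans (box-connected x) (sym (box-connected y)))

  private
    positive : ∀ {m} → (m ≡ 0 → ⊥) → 1 ≤ m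
    positive {zero} h = ⊥-elim (h refl)
    positive {suc m} h = s≤s z≤n

  -- With differently labelled terminals and no further edges the `F` term vanishes.
  boxT-positive : 1 ≤ boxT
  boxT-positive = positive λ z → <-irrefl (sym (cong₂ _+_
      (trans (cong (boxF *_) (cong (if_then 1 else 0) (dec-false (allEq? (ρ ∘ inj₁) (false ∷ true ∷ []))
        λ h → case h (here refl) (there (here refl)) of λ ()))) (*-zeroʳ boxF))
      (trans (unlessEq-no (ρ ∘ inj₁) false true λ ()) (cong (_* cnt (merge (ρ ∘ inj₁) false true) (false ∷ true ∷ []) []) z))))
    (box-count ρ (λ e → toℕ-injective (+-cancelˡ-≡ 2 _ _ e)) (λ { i false () ; i true () }))
    where
    ρ : Bool ⊎ Fin (2 + k) → ℕ
    ρ (inj₁ false) = 0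
    ρ (inj₁ true) = 1
    ρ (inj₂ i) = 2 + toℕ i

  -- Equal labels on the terminals remove the `T` term.
  boxF-positive : 1 ≤ boxF
  boxF-positive = positive λ z → <-irrefl (sym (cong₂ _+_
      (cong (_* cnt (ρ ∘ inj₁) (false ∷ true ∷ []) []) z) (unlessEq-yes (ρ ∘ inj₁) false true refl)))
    (box-count ρ (λ e → toℕ-injective (+-cancelˡ-≡ 1 _ _ e)) (λ { i b () }))
    where
    ρ : Bool ⊎ Fin (2 + k) → ℕ
    ρ (inj₁ b) = 0
    ρ (inj₂ i) = 1 + toℕ i

  F-positive : (N : Net p d) → 1 ≤ F N
  F-positive box = boxF-positive
  F-positive edge = s≤s z≤n
  F-positive (ext N) = ≤-trans (F-positive N) (m≤m+n _ _)
  F-positive (par N M) = *-mono-≤ (F-positive N) (F-positive M)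

  T-positive : (N : Net p d) → 1 ≤ T N
  T-positive box = boxT-positive
  T-positive edge = s≤s z≤n
  T-positive (ext N) = T-positive N
  T-positive (par N M) = ≤-trans (*-mono-≤ (T-positive N) (F-positive M)) (m≤m+n _ _)

  _≟ⁱ_ : {N : Net p d} → DecidableEquality (Inner N)
  _≟ⁱ_ {N = box} = _≟ᶠ_
  _≟ⁱ_ {N = edge} = λ ()
  _≟ⁱ_ {N = ext N} = ⊎-≡-dec _≟ᵇ_ (_≟ⁱ_ {N = N})
  _≟ⁱ_ {N = par N M} = ⊎-≡-dec (_≟ⁱ_ {N = N}) (_≟ⁱ_ {N = M})

  dec : (N : Net p d) → DecidableEquality (Vertex N)
  dec N = ⊎-≡-dec _≟ᵇ_ (_≟ⁱ_ {N = N})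

  module _ (N : Net p d) (M : Net q e) where
    left : Vertex N → Bool ⊎ (Inner N ⊎ Inner M)
    left = Sum.map₂ inj₁

    right : Vertex M → Bool ⊎ (Inner N ⊎ Inner M)
    right = Sum.map₂ inj₂

    left-injective : Injective _≡_ _≡_ left
    left-injective {inj₁ _} {inj₁ _} refl = refl
    left-injective {inj₂ _} {inj₂ _} refl = refl

    right-injective : Injective _≡_ _≡_ right
    right-injective {inj₁ _} {inj₁ _} refl = refl
    right-injective {inj₂ _} {inj₂ _} refl = refl

  boxVertices-unique : Unique (inj₁ false ∷ inj₁ true ∷ boxInner)
  boxVertices-unique = ((λ ()) ∷ All.map⁺ (All.tabulate λ _ ()))
    ∷ All.map⁺ (All.tabulate λ _ ()) ∷ Unique.map⁺ inj₂-injective (Unique.allFin⁺ (2 + k))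

  boxVertices-complete : ∀ v → v ∈ inj₁ false ∷ inj₁ true ∷ boxInner
  boxVertices-complete (inj₁ false) = here refl
  boxVertices-complete (inj₁ true) = there (here refl)
  boxVertices-complete (inj₂ i) = there (there (∈-map⁺ inj₂ (∈-allFin i)))

  -- Putting the missing edge in front of `boxEdges` gives, by computation, `complete` of all
  -- vertices with the terminals listed first.
  box-degree : ∀ v → suc (deg (dec box) ((inj₁ false , inj₁ true) ∷ boxEdges) v) ≡ 4 + k
  box-degree v = trans (deg-complete (dec box) _ boxVertices-unique (boxVertices-complete v))
    (cong (2 +_) (trans (length-map inj₂ (allFin (2 + k))) (length-tabulate {n = 2 + k} id)))

  deg-terminal : (N : Net p d) → ∀ b → deg (dec N) (edges N) (inj₁ b) ≡ d
  deg-inner : (N : Net p d) → ∀ i → deg (dec N) (edges N) (inj₂ i) ≡ 3 + k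

  deg-terminal box false = suc-injective (suc-injective (box-degree (inj₁ false)))
  deg-terminal box true = suc-injective (suc-injective (box-degree (inj₁ true)))
  deg-terminal edge false = refl
  deg-terminal edge true = refl
  deg-terminal N@(ext M) b = trans (deg-++ (dec N) (mapE inj₂ (edges M)) _ (inj₁ b))
    (cong₂ _+_ (deg-outside (dec N) inj₂ (edges M) λ _ ()) (spoke b))
    where
    spoke : ∀ b → deg (dec N) (map (λ b → inj₂ (inj₁ b) , inj₁ b) (false ∷ true ∷ [])) (inj₁ b) ≡ 1
    spoke false = refl
    spoke true = refl
  deg-terminal P@(par N M) b = trans (deg-++ (dec P) (mapE (left N M) (edges N)) _ (inj₁ b)) (cong₂ _+_
    (trans (deg-map (dec P) (dec N) (left N M) (left-injective N M) (edges N) (inj₁ b)) (deg-terminal N b))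
    (trans (deg-map (dec P) (dec M) (right N M) (right-injective N M) (edges M) (inj₁ b)) (deg-terminal M b)))

  deg-inner box i = suc-injective (box-degree (inj₂ i))
  deg-inner N@(ext M) (inj₁ b) = trans (deg-++ (dec N) (mapE inj₂ (edges M)) _ (inj₂ (inj₁ b)))
    (trans (cong₂ _+_ (trans (deg-map (dec N) (dec M) inj₂ inj₂-injective (edges M) (inj₁ b)) (deg-terminal M b)) (spoke b))
      (+-comm _ 1))
    where
    spoke : ∀ b → deg (dec N) (map (λ b → inj₂ (inj₁ b) , inj₁ b) (false ∷ true ∷ [])) (inj₂ (inj₁ b)) ≡ 1
    spoke false = refl
    spoke true = refl
  deg-inner N@(ext M) (inj₂ i) = trans (deg-++ (dec N) (mapE inj₂ (edges M)) _ (inj₂ (inj₂ i)))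
    (trans (cong (_+ 0) (trans (deg-map (dec N) (dec M) inj₂ inj₂-injective (edges M) (inj₂ i)) (deg-inner M i))) (+-identityʳ _))
  deg-inner P@(par N M) (inj₁ i) = trans (deg-++ (dec P) (mapE (left N M) (edges N)) _ (inj₂ (inj₁ i))) (trans (cong₂ _+_
    (trans (deg-map (dec P) (dec N) (left N M) (left-injective N M) (edges N) (inj₂ i)) (deg-inner N i))
    (deg-outside (dec P) (right N M) (edges M) λ { (inj₁ _) () ; (inj₂ _) () })) (+-identityʳ _))
  deg-inner P@(par N M) (inj₂ i) = trans (deg-++ (dec P) (mapE (left N M) (edges N)) _ (inj₂ (inj₂ i))) (cong₂ _+_
    (deg-outside (dec P) (left N M) (edges N) λ { (inj₁ _) () ; (inj₂ _) () })
    (trans (deg-map (dec P) (dec M) (right N M) (right-injective N M) (edges M) (inj₂ i)) (deg-inner M i)))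

  Touches : {I : Set} → (Bool ⊎ I) × (Bool ⊎ I) → Set
  Touches (a , b) = ∃ λ i → a ≡ inj₂ i ⊎ b ≡ inj₂ i

  -- In a parallel composition such an inner end is foreign to the other network, so no edge of the
  -- second factor repeats one of the first.
  edges-touch : (N : Net true d) → ∀ {e} → e ∈ edges N → Touches e
  edges-touch box m with ∈-++⁻ (star (inj₁ false) boxInner) m
  ... | inj₁ s with ∈-map⁻ (inj₁ false ,_) s
  ... | _ , r , refl with ∈-map⁻ inj₂ r
  ... | i , _ , refl = i , inj₂ refl
  edges-touch box m | inj₂ s with ∈-map⁻ inj₂ (complete-∈ʳ _ boxInner s)
  ... | i , _ , refl = i , inj₂ refl
  edges-touch (ext M) m with ∈-++⁻ (mapE inj₂ (edges M)) m
  ... | inj₁ s with ∈-map⁻ (Product.map inj₂ inj₂) s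
  ... | (a , b) , _ , refl = a , inj₁ refl
  edges-touch (ext M) m | inj₂ s with ∈-map⁻ (λ b → inj₂ (inj₁ b) , inj₁ b) s
  ... | b , _ , refl = inj₁ b , inj₁ refl
  edges-touch (par N M) m with ∈-++⁻ (mapE (left N M) (edges N)) m
  ... | inj₁ s with ∈-map⁻ (Product.map (left N M) (left N M)) s
  ... | _ , r , refl with edges-touch N r
  ... | i , inj₁ refl = inj₁ i , inj₁ refl
  ... | i , inj₂ refl = inj₁ i , inj₂ refl
  edges-touch (par N M) m | inj₂ s with ∈-map⁻ (Product.map (right N M) (right N M)) s
  ... | _ , r , refl with edges-touch M r
  ... | i , inj₁ refl = inj₂ i , inj₁ refl
  ... | i , inj₂ refl = inj₂ i , inj₂ refl

  edges-simple : (N : Net p d) → SimpleEdges (edges N)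
  edges-simple box with complete-simple _ boxVertices-unique
  ... | _ ∷ d , _ ∷ l = d , l
  edges-simple edge = ([] ∷ []) , (λ ()) ∷ []
  edges-simple (ext M) = ++-simple (map-simple inj₂-injective (edges-simple M))
    ((((λ { (inj₁ ()) ; (inj₂ ()) }) ∷ []) ∷ [] ∷ []) , (λ ()) ∷ (λ ()) ∷ []) apart
    where
    apart : ∀ {e f} → e ∈ mapE inj₂ (edges M) → f ∈ map (λ b → inj₂ (inj₁ b) , inj₁ b) (false ∷ true ∷ []) → Distinct e f
    apart m m' s with ∈-map⁻ (Product.map inj₂ inj₂) m | ∈-map⁻ (λ b → inj₂ (inj₁ b) , inj₁ b) m'
    apart m m' (inj₁ ()) | _ , _ , refl | _ , _ , refl
    apart m m' (inj₂ ()) | _ , _ , refl | _ , _ , refl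
  edges-simple (par N M) = ++-simple (map-simple (left-injective N M) (edges-simple N)) (map-simple (right-injective N M) (edges-simple M)) apart
    where
    off : ∀ a {b i} → b ≡ inj₂ i → left N M a ≢ right N M b
    off (inj₁ _) refl ()
    off (inj₂ _) refl ()
    apart : ∀ {e f} → e ∈ mapE (left N M) (edges N) → f ∈ mapE (right N M) (edges M) → Distinct e f
    apart m m' s with ∈-map⁻ (Product.map (left N M) (left N M)) m | ∈-map⁻ (Product.map (right N M) (right N M)) m'
    ... | (a , b) , _ , refl | _ , r , refl with edges-touch M r | s
    ... | i , inj₁ h | inj₁ s' = off a h (cong proj₁ s')
    ... | i , inj₂ h | inj₁ s' = off b h (cong proj₂ s')
    ... | i , inj₁ h | inj₂ s' = off b h (cong proj₂ s')
    ... | i , inj₂ h | inj₂ s' = off a h (cong proj₁ s')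

  module _ (N : Net p d) (d≡ : d ≡ 3 + k) where
    private
      place : Vertex N → Fin (2 + size N)
      place = Inverse.to (vertex↔ N)

      unplace : Fin (2 + size N) → Vertex N
      unplace = Inverse.from (vertex↔ N)

      place-unplace : ∀ v → place (unplace v) ≡ v
      place-unplace = Inverse.strictlyInverseˡ (vertex↔ N)

      place-injective : Injective _≡_ _≡_ place
      place-injective {x} {y} h = trans (sym (Inverse.strictlyInverseʳ (vertex↔ N) x))
        (trans (cong unplace h) (Inverse.strictlyInverseʳ (vertex↔ N) y))

      E : Edges (Fin (2 + size N))
      E = mapE place (edges N)

      vs : List (Fin (2 + size N))
      vs = map (place ∘ inj₂) (inner N) ++ map (place ∘ inj₁) (false ∷ true ∷ [])

      E-simple : SimpleEdges E
      E-simple = map-simple place-injective (edges-simple N)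

      vs-complete : ∀ v → v ∈ vs
      vs-complete v = subst (_∈ vs) (place-unplace v) (at (unplace v))
        where
        at : ∀ x → place x ∈ vs
        at (inj₁ false) = ∈-++⁺ʳ (map (place ∘ inj₂) (inner N)) (here refl)
        at (inj₁ true) = ∈-++⁺ʳ (map (place ∘ inj₂) (inner N)) (there (here refl))
        at (inj₂ i) = ∈-++⁺ˡ (∈-map⁺ (place ∘ inj₂) (inner-complete N i))

    netGraph : Graph (2 + size N)
    netGraph = graph E

    netGraph-simple : IsSimple netGraph
    netGraph-simple = graph-simple E (proj₂ E-simple)

    netGraph-regular : IsRegular (3 + k) netGraph
    netGraph-regular v = trans (degree-graph E E-simple v)
      (subst (λ v → deg _≟ᶠ_ E v ≡ 3 + k) (place-unplace v)
        (trans (deg-map _≟ᶠ_ (dec N) place place-injective (edges N) (unplace v)) (at (unplace v))))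
      where
      at : ∀ x → deg (dec N) (edges N) x ≡ 3 + k
      at (inj₁ b) = trans (deg-terminal N b) d≡
      at (inj₂ i) = deg-inner N i

    -- Here the surroundings are the two bare terminals: they are unconnected, which kills the `F`
    -- term, and once merged they contribute a factor 1 to the `T` term.
    netGraph-tau : HasTau netGraph (T N)
    netGraph-tau = subst (HasTau netGraph) total (hasTau E-simple vs-complete)
      where
      open ≡-Reasoning
      β : Bool → ℕ
      β = toℕ ∘ place ∘ inj₁
      bs = false ∷ true ∷ []
      place-≢ : ∀ {x y} → x ≢ y → toℕ (place x) ≢ toℕ (place y)
      place-≢ ne h = ne (place-injective (toℕ-injective h))
      total : cnt toℕ vs E ≡ T N
      total = begin
        cnt toℕ vs E
          ≡⟨ cong (cnt toℕ vs) (sym (++-identityʳ E)) ⟩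
        cnt toℕ vs (E ++ [])
          ≡⟨ process (net-transfer N) toℕ place (place ∘ inj₁) id bs [] (λ h → inj₂-injective (place-injective (toℕ-injective h)))
               (λ i b → place-≢ {inj₂ i} {inj₁ b} λ ()) (λ _ → refl) (λ { false → here refl ; true → there (here refl) }) ⟩
        F N * cnt β bs [] + unlessEq β false true 0 (T N * cnt (merge β false true) bs [])
          ≡⟨ cong₂ _+_ (trans (cong (F N *_) (cong (if_then 1 else 0) (dec-false (allEq? β bs) λ h →
               place-≢ {inj₁ false} {inj₁ true} (λ ()) (h (here refl) (there (here refl)))))) (*-zeroʳ (F N)))
               (unlessEq-no β false true (place-≢ {inj₁ false} {inj₁ true} λ ())) ⟩
        T N * cnt (merge β false true) bs []
          ≡⟨ cong (T N *_) (cong (if_then 1 else 0) (dec-true (allEq? (merge β false true) bs) joined)) ⟩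
        T N * 1
          ≡⟨ *-identityʳ (T N) ⟩
        T N ∎
        where
        joined : AllEq (merge β false true) bs
        joined (here refl) (here refl) = refl
        joined (here refl) (there (here refl)) = merge-joins β false true
        joined (there (here refl)) (here refl) = sym (merge-joins β false true)
        joined (there (here refl)) (there (here refl)) = refl

    netGraph-connected : Connected netGraph
    netGraph-connected with T N | T-positive N | netGraph-tau
    ... | suc t | _ | tau = tau-connected tau

-- Ladders

module Ladders (k : ℕ) where
  open Networks k

  rungs : ∀ j → Net p (2 + k) → Net true (suc j)
  rungs zero N = ext N
  rungs (suc j) N = par (ext box) (rungs j N)

  -- Both kinds bring the terminals back to degree `2 + k`. Type `false` has a plain edge where type
  -- `true` has one more gadget, hence `4 + k` fewer vertices.
  step′ : (b : Bool) → Net p (2 + k) → Net b (2 + k)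
  step′ true N = rungs (suc k) N
  step′ false N = par edge (rungs k N)

  -- Each letter uses both kinds of step once and differs from the other only in their order; so
  -- words of equal length have equal size.
  letter : (b : Bool) → Net p (2 + k) → Net b (2 + k)
  letter b N = step′ b (step′ (not b) N)

  private
    t f : ℕ
    t = boxT
    f = boxF + 2 * boxT

    -- `α j` and `β j` are the `T` and `F` of `j` gadgets `ext box` in parallel, starting from the
    -- empty network with values 0 and 1.
    α β : ℕ → ℕ
    α zero = 0
    α (suc j) = t * β j + f * α j
    β zero = 1
    β (suc j) = f * β j

    f-positive : 1 ≤ f
    f-positive = ≤-trans boxF-positive (m≤m+n _ _)

    β-positive : ∀ j → 1 ≤ β j
    β-positive zero = s≤s z≤n
    β-positive (suc j) = *-mono-≤ f-positive (β-positive j)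

    F-rungs : ∀ j (N : Net p (2 + k)) → F (rungs j N) ≡ β j * (F N + 2 * T N)
    F-rungs zero N = sym (*-identityˡ _)
    F-rungs (suc j) N = trans (cong (f *_) (F-rungs j N)) (sym (*-assoc f (β j) _))

    T-rungs : ∀ j (N : Net p (2 + k)) → T (rungs j N) ≡ α j * (F N + 2 * T N) + β j * T N
    T-rungs zero N = sym (*-identityˡ _)
    T-rungs (suc j) N = trans (cong₂ (λ x y → t * x + f * y) (F-rungs j N) (T-rungs j N))
      (solve 6 (λ t f a b S T → t :* (b :* S) :+ f :* (a :* S :+ b :* T) := (t :* b :+ f :* a) :* S :+ f :* b :* T)
        refl t f (α j) (β j) (F N + 2 * T N) (T N))
      where open +-*-Solver

  -- The conductance T / F of a step of type true is less than that of a step of type false: continuing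
  -- the ladder contributes T / (F + 2T) < 1/2, and the rung of type false contributes 1 where the
  -- other contributes t / f ≤ 1/2.
  step-conductance : (N : Net p (2 + k)) (M : Net q (2 + k)) →
    T (step′ true N) * F (step′ false M) < T (step′ false M) * F (step′ true N)
  step-conductance N M = begin-strict
    T (step′ true N) * F (step′ false M)
      ≡⟨ cong₂ _*_ (T-rungs (suc k) N) (trans (*-identityˡ (F (rungs k M))) (F-rungs k M)) ⟩
    ((t * b + f * a) * S + f * b * T N) * (b * S′)
      ≡⟨ solve 7 (λ t f a b S T S′ → ((t :* b :+ f :* a) :* S :+ f :* b :* T) :* (b :* S′)
           := (t :* S :+ f :* T) :* (b :* b :* S′) :+ f :* a :* b :* S :* S′) refl t f a b S (T N) S′ ⟩
    -- After clearing denominators, the `k` gadgets common to both types contribute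
    -- `f * a * b * S * S′` to both sides.
    (t * S + f * T N) * (b * b * S′) + f * a * b * S * S′
      <⟨ +-monoˡ-< (f * a * b * S * S′) (*-monoˡ-< (b * b * S′) {{>-nonZero bbS′}} core) ⟩
    f * S * (b * b * S′) + f * a * b * S * S′
      -- The continuation `M` can only increase the right-hand side.
      ≤⟨ m≤m+n _ (f * b * b * T M * S) ⟩
    f * S * (b * b * S′) + f * a * b * S * S′ + f * b * b * T M * S
      ≡⟨ solve 6 (λ f a b S S′ T′ → f :* S :* (b :* b :* S′) :+ f :* a :* b :* S :* S′ :+ f :* b :* b :* T′ :* S
           := (con 1 :* (b :* S′) :+ con 1 :* (a :* S′ :+ b :* T′) ) :* (f :* b :* S) ) refl f a b S S′ (T M) ⟩
    (1 * (b * S′) + 1 * (a * S′ + b * T M)) * (f * b * S)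
      ≡⟨ cong₂ _*_ (cong₂ (λ x y → 1 * x + 1 * y) (sym (F-rungs k M)) (sym (T-rungs k M))) (sym (F-rungs (suc k) N)) ⟩
    T (step′ false M) * F (step′ true N) ∎
    where
    open ≤-Reasoning
    open +-*-Solver
    a = α k
    b = β k
    S = F N + 2 * T N
    S′ = F M + 2 * T M
    bbS′ : 0 < b * b * S′
    bbS′ = *-mono-≤ (*-mono-≤ (β-positive k) (β-positive k)) (≤-trans (F-positive M) (m≤m+n _ _))
    -- This is `t / f + T N / S < 1` without denominators: `2 * t ≤ f` by definition of `f`, and
    -- `2 * T N < S` since `F N` is positive.
    core : t * S + f * T N < f * S
    core = *-cancelˡ-< 2 (t * S + f * T N) (f * S) (begin-strict
      2 * (t * S + f * T N)
        ≡⟨ solve 4 (λ t f S T → con 2 :* (t :* S :+ f :* T) := con 2 :* t :* S :+ f :* (con 2 :* T)) refl t f S (T N) ⟩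
      2 * t * S + f * (2 * T N)
        <⟨ +-mono-≤-< (*-monoˡ-≤ S (m≤n+m (2 * t) boxF)) (*-monoʳ-< f {{>-nonZero f-positive}} (m<n+m (2 * T N) (F-positive N))) ⟩
      f * S + f * S
        ≡⟨ solve 1 (λ x → x :+ x := con 2 :* x) refl (f * S) ⟩
      2 * (f * S) ∎)

  private
    affine-injective : ∀ a b {S T S′ T′} → 1 ≤ b → b * S ≡ b * S′ → a * S + b * T ≡ a * S′ + b * T′ → S ≡ S′ × T ≡ T′
    affine-injective a (suc b) {S} {T} {S′} {T′} _ e g with *-cancelˡ-≡ S S′ (suc b) e
    ... | refl = refl , *-cancelˡ-≡ T T′ (suc b) (+-cancelˡ-≡ (a * S) _ _ g)

    -- In the unknowns `F + 2 * T` and `T` the system is triangular with diagonal entries `β j`,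
    -- which are positive.
    rungs-injective : ∀ j (N : Net p (2 + k)) (M : Net q (2 + k)) → T (rungs j N) ≡ T (rungs j M) →
      F (rungs j N) ≡ F (rungs j M) → T N ≡ T M × F N ≡ F M
    rungs-injective j N M e g with affine-injective (α j) (β j) {F N + 2 * T N} {T N} {F M + 2 * T M} {T M} (β-positive j)
      (trans (sym (F-rungs j N)) (trans g (F-rungs j M))) (trans (sym (T-rungs j N)) (trans e (T-rungs j M)))
    ... | S≡ , T≡ = T≡ , +-cancelʳ-≡ (2 * T N) _ _ (trans S≡ (cong (λ x → F M + 2 * x) (sym T≡)))

  -- Steps of different types cannot agree in both numbers, as their conductances differ; steps of
  -- one type act on the numbers by an injective linear map.
  step-injective : ∀ b c (N : Net p (2 + k)) (M : Net q (2 + k)) → T (step′ b N) ≡ T (step′ c M) → F (step′ b N) ≡ F (step′ c M) →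
    b ≡ c × T N ≡ T M × F N ≡ F M
  step-injective true true N M e g = refl , rungs-injective (suc k) N M e g
  step-injective false false N M e g = refl , rungs-injective k N M
    (+-cancelˡ-≡ (F (rungs k M)) _ _ (trans (cong (_+ T (rungs k N)) (sym F≡)) (trans (sym (ones N)) (trans e (ones M))))) F≡
    where
    F≡ : F (rungs k N) ≡ F (rungs k M)
    F≡ = trans (sym (*-identityˡ _)) (trans g (*-identityˡ _))
    ones : ∀ {p} (N : Net p (2 + k)) → T (step′ false N) ≡ F (rungs k N) + T (rungs k N)
    ones N = cong₂ _+_ (*-identityˡ (F (rungs k N))) (*-identityˡ (T (rungs k N)))
  step-injective true false N M e g = ⊥-elim (<-irrefl (cong₂ _*_ e (sym g)) (step-conductance N M))
  step-injective false true N M e g = ⊥-elim (<-irrefl (cong₂ _*_ (sym e) g) (step-conductance M N))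

  letter-injective : ∀ b c (N : Net p (2 + k)) (M : Net q (2 + k)) → T (letter b N) ≡ T (letter c M) →
    F (letter b N) ≡ F (letter c M) → b ≡ c × T N ≡ T M × F N ≡ F M
  letter-injective b c N M e g =
    let b≡c , e′ , g′ = step-injective b c (step′ (not b) N) (step′ (not c) M) e g
        _ , e″ , g″ = step-injective (not b) (not c) N M e′ g′
    in b≡c , e″ , g″

  -- Whether the terminals are adjacent depends on the outermost step, so this index has to be
  -- hidden.
  Ladder : Set
  Ladder = ∃ λ p → Net p (2 + k)

  word : ∀ {L} → Vec Bool L → Ladder → Ladder
  word [] N = N
  word (b ∷ w) N = b , letter b (proj₂ (word w N))

  -- The filler on which words are built. It is common to all the words compared, so only its size
  -- matters.
  pad : ℕ → Ladder
  pad zero = true , box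
  pad (suc r) = false , step′ false (proj₂ (pad r))

  word-injective : ∀ {L} (v w : Vec Bool L) N → T (proj₂ (word v N)) ≡ T (proj₂ (word w N)) →
    F (proj₂ (word v N)) ≡ F (proj₂ (word w N)) → v ≡ w
  word-injective [] [] N e g = refl
  word-injective (b ∷ v) (c ∷ w) N e g with letter-injective b c (proj₂ (word v N)) (proj₂ (word w N)) e g
  ... | refl , e′ , g′ = cong (b ∷_) (word-injective v w N e′ g′)

  sizeB letterSize : ℕ
  sizeB = k * (4 + k) + 2
  letterSize = ((1 + k) * (4 + k) + 2) + sizeB

  size-rungs : ∀ j (N : Net p (2 + k)) → size (rungs j N) ≡ j * (4 + k) + 2 + size N
  size-rungs zero N = refl
  size-rungs (suc j) N = trans (cong (4 + k +_) (size-rungs j N))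
    (solve 3 (λ c x y → c :+ (x :+ con 2 :+ y) := c :+ x :+ con 2 :+ y) refl (4 + k) (j * (4 + k)) (size N))
    where open +-*-Solver

  size-letter : ∀ b (N : Net p (2 + k)) → size (letter b N) ≡ letterSize + size N
  size-letter true N = trans (size-rungs (suc k) (step′ false N)) (trans (cong (suc k * (4 + k) + 2 +_) (size-rungs k N))
    (sym (+-assoc (suc k * (4 + k) + 2) sizeB (size N))))
  size-letter false N = trans (size-rungs k (step′ true N)) (trans (cong (k * (4 + k) + 2 +_) (size-rungs (suc k) N))
    (trans (sym (+-assoc sizeB (suc k * (4 + k) + 2) (size N))) (cong (_+ size N) (+-comm sizeB (suc k * (4 + k) + 2)))))

  size-word : ∀ {L} (w : Vec Bool L) N → size (proj₂ (word w N)) ≡ L * letterSize + size (proj₂ N)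
  size-word [] N = refl
  size-word {suc L} (b ∷ w) N = trans (size-letter b (proj₂ (word w N)))
    (trans (cong (letterSize +_) (size-word w N)) (sym (+-assoc letterSize (L * letterSize) _)))

  size-pad : ∀ r → size (proj₂ (pad r)) ≡ r * sizeB + (2 + k)
  size-pad zero = refl
  size-pad (suc r) = trans (size-rungs k (proj₂ (pad r))) (trans (cong (sizeB +_) (size-pad r)) (sym (+-assoc sizeB (r * sizeB) _)))

  -- The cap `letter b box` uses `2 + k` units of degree at each terminal and the extended word the
  -- last one. Both caps have the same size.
  closed : ∀ {L} (b : Bool) → Vec Bool L → ℕ → Net b ((2 + k) + 1)
  closed b w r = par (letter b box) (ext (proj₂ (word w (pad r))))

  size-closed : ∀ {L} b (w : Vec Bool L) r → 2 + size (closed b w r) ≡ 8 + 2 * k + (suc L * letterSize + r * sizeB)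
  size-closed {L} b w r = trans (cong₂ (λ x y → 2 + (x + (2 + y))) (size-letter b box)
      (trans (size-word w (pad r)) (cong (L * letterSize +_) (size-pad r))))
    (solve 4 (λ k M LM x → con 2 :+ ((M :+ (con 2 :+ k)) :+ (con 2 :+ (LM :+ (x :+ (con 2 :+ k)))))
      := con 8 :+ con 2 :* k :+ ((M :+ LM) :+ x)) refl k letterSize (L * letterSize) (r * sizeB))
    where open +-*-Solver

  private
    -- Cramer's rule in natural numbers: `suc o` below is the determinant `x′ * y - x * y′`, and
    -- `side` eliminates the second unknown without subtracting.
    cramer : ∀ {x y x′ y′ p q p′ q′} → x * y′ < x′ * y → x * p + y * q ≡ x * p′ + y * q′ →
      x′ * p + y′ * q ≡ x′ * p′ + y′ * q′ → p ≡ p′ × y * q ≡ y * q′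
    cramer {x} {y} {x′} {y′} {p} {q} {p′} {q′} lt e g with m≤n⇒∃[o]m+o≡n lt
    ... | o , D = p≡ , +-cancelˡ-≡ (x * p) _ _ (trans e (cong (λ z → x * z + y * q′) (sym p≡)))
      where
      open ≡-Reasoning
      open +-*-Solver
      side : ∀ p q → suc o * p + y′ * (x * p + y * q) ≡ y * (x′ * p + y′ * q)
      side p q = begin
        suc o * p + y′ * (x * p + y * q)
          ≡⟨ solve 6 (λ o p q x y y′ → (con 1 :+ o) :* p :+ y′ :* (x :* p :+ y :* q)
               := (con 1 :+ x :* y′ :+ o) :* p :+ y :* y′ :* q) refl o p q x y y′ ⟩
        (1 + x * y′ + o) * p + y * y′ * q
          ≡⟨ cong (λ z → z * p + y * y′ * q) D ⟩
        x′ * y * p + y * y′ * q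
          ≡⟨ solve 5 (λ x′ y y′ p q → x′ :* y :* p :+ y :* y′ :* q := y :* (x′ :* p :+ y′ :* q)) refl x′ y y′ p q ⟩
        y * (x′ * p + y′ * q) ∎
      p≡ : p ≡ p′
      p≡ = *-cancelˡ-≡ p p′ (suc o) (+-cancelʳ-≡ (y′ * (x * p + y * q)) _ _ (begin
        suc o * p + y′ * (x * p + y * q) ≡⟨ side p q ⟩
        y * (x′ * p + y′ * q) ≡⟨ cong (y *_) g ⟩
        y * (x′ * p′ + y′ * q′) ≡⟨ sym (side p′ q′) ⟩
        suc o * p′ + y′ * (x * p′ + y * q′) ≡⟨ cong (λ z → suc o * p′ + y′ * z) (sym e) ⟩
        suc o * p′ + y′ * (x * p + y * q) ∎))

  -- T (closed b w r) is linear in (F , T) of the word, and the two functionals b = true, false are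
  -- linearly independent, so together they determine w.
  closed-injective : ∀ {L} (v w : Vec Bool L) r → T (closed true v r) ≡ T (closed true w r) →
    T (closed false v r) ≡ T (closed false w r) → v ≡ w
  closed-injective v w r e g = word-injective v w (pad r) T≡
    (+-cancelʳ-≡ (2 * T N) _ _ (trans (proj₁ solved) (cong (λ z → F M + 2 * z) (sym T≡))))
    where
    N = proj₂ (word v (pad r))
    M = proj₂ (word w (pad r))
    solved : F N + 2 * T N ≡ F M + 2 * T M × F (letter true box) * T N ≡ F (letter true box) * T M
    solved = cramer {T (letter true box)} {F (letter true box)} {T (letter false box)} {F (letter false box)}
      -- The determinant is nonzero because the outermost steps of the two caps have different
      -- types, hence different conductances.
      (step-conductance (step′ false box) (step′ true box)) e g
    T≡ : T N ≡ T M
    T≡ = *-cancelˡ-≡ (T N) (T M) (F (letter true box)) {{>-nonZero (F-positive (letter true box))}} (proj₂ solved)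

-- Counting values

lookup-unique : ∀ {A : Set} {xs : List A} → Unique xs → Injective _≡_ _≡_ (List.lookup xs)
lookup-unique (h ∷ u) {zero} {zero} e = refl
lookup-unique {xs = x ∷ xs} (h ∷ u) {zero} {suc j} e = ⊥-elim (All.lookup h (∈-lookup {xs = xs} j) e)
lookup-unique {xs = x ∷ xs} (h ∷ u) {suc i} {zero} e = ⊥-elim (All.lookup h (∈-lookup {xs = xs} i) (sym e))
lookup-unique (h ∷ u) {suc i} {suc j} e = cong suc (lookup-unique u e)

values : ∀ {A : Set} → (A → ℕ) → List A → List ℕ
values f xs = deduplicate _≟_ (map f xs)

-- An element is determined by its pair of values, so the list injects into the product of the two
-- sets of values.
values-product : ∀ {A : Set} (f g : A → ℕ) {xs} → Unique xs → (∀ {x y} → f x ≡ f y → g x ≡ g y → x ≡ y) →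
  length xs ≤ length (values f xs) * length (values g xs)
values-product f g {xs} u inj = injective⇒≤ {f = λ i → combine (code f i) (code g i)} λ {i} {j} e →
    let p , q = combine-injective (code f i) (code g i) (code f j) (code g j) e in
    lookup-unique u (inj (decode f p) (decode g q))
  where
  member : ∀ h i → h (List.lookup xs i) ∈ values h xs
  member h i = ∈-deduplicate⁺ _≟_ (∈-map⁺ h (∈-lookup i))
  code : ∀ h → Fin (length xs) → Fin (length (values h xs))
  code h i = index (member h i)
  decode : ∀ h {i j} → code h i ≡ code h j → h (List.lookup xs i) ≡ h (List.lookup xs j)
  decode h {i} {j} e = trans (lookup-index (member h i)) (trans (cong (List.lookup (values h xs)) e) (sym (lookup-index (member h j))))

allWords : ∀ L → List (Vec Bool L)
allWords zero = [] ∷ []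
allWords (suc L) = map (true ∷_) (allWords L) ++ map (false ∷_) (allWords L)

length-allWords : ∀ L → length (allWords L) ≡ 2 ^ L
length-allWords zero = refl
length-allWords (suc L) = trans (length-++ (map (true ∷_) (allWords L))) (cong₂ _+_
  (trans (length-map (true ∷_) (allWords L)) (length-allWords L))
  (trans (length-map (false ∷_) (allWords L)) (trans (length-allWords L) (sym (+-identityʳ _)))))

allWords-unique : ∀ L → Unique (allWords L)
allWords-unique zero = [] ∷ []
allWords-unique (suc L) = Unique.++⁺ (Unique.map⁺ ∷-injectiveʳ (allWords-unique L)) (Unique.map⁺ ∷-injectiveʳ (allWords-unique L))
  λ (p , q) → case ∈-map⁻ (true ∷_) p , ∈-map⁻ (false ∷_) q of λ { ((_ , _ , refl) , (_ , _ , ())) }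

Realisable : ℕ → ℕ → ℕ → Set
Realisable k n v = Σ (Graph n) λ G → (IsSimple G × IsRegular k G × Connected G) × HasTau G v

atLeastDistinct : ∀ {k n vs} → Unique vs → (∀ {v} → v ∈ vs → Realisable k n v) → AtLeastDistinctTau k n (length vs)
atLeastDistinct {vs = vs} u real = (λ i → proj₁ (r i)) , List.lookup vs , (λ i → proj₁ (proj₂ (r i))) , (λ i → proj₂ (proj₂ (r i))) , lookup-unique u
  where
  r = λ i → real (∈-lookup {xs = vs} i)

halve : ∀ n → ∃ λ h → n ≡ 2 * h ⊎ n ≡ suc (2 * h)
halve zero = 0 , inj₁ refl
halve (suc n) with halve n
... | h , inj₁ refl = h , inj₂ refl
... | h , inj₂ refl = suc h , inj₁ (sym (*-suc 2 h))

-- Attaining all large orders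

module Counting (k : ℕ) where
  open Networks k
  open Ladders k

  realise : ∀ {p d n} (N : Net p d) → d ≡ 3 + k → 2 + size N ≡ n → Realisable (3 + k) n (T N)
  realise N d≡ refl = netGraph N d≡ , (netGraph-simple N d≡ , netGraph-regular N d≡ , netGraph-connected N d≡) , netGraph-tau N d≡

  order : ℕ → ℕ → ℕ
  order L r = 8 + 2 * k + (suc L * letterSize + r * sizeB)

  manyValues : ∀ L r → Σ ℕ λ m → 2 ^ L ≤ m * m × AtLeastDistinctTau (3 + k) (order L r) m
  -- The closing with more values is kept; the square of its number of values is at least the
  -- product.
  manyValues L r = case ≤-total (length (vals true)) (length (vals false)) of λ where
      (inj₁ le) → choose false (*-monoˡ-≤ (length (vals false)) le)
      (inj₂ le) → choose true (*-monoʳ-≤ (length (vals true)) le)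
    where
    τ : Bool → Vec Bool L → ℕ
    τ b w = T (closed b w r)
    vals : Bool → List ℕ
    vals b = values (τ b) (allWords L)
    total : 2 ^ L ≤ length (vals true) * length (vals false)
    total = subst (_≤ length (vals true) * length (vals false)) (length-allWords L)
      (values-product (τ true) (τ false) (allWords-unique L) λ {v} {w} e g → closed-injective v w r e g)
    choose : ∀ b → length (vals true) * length (vals false) ≤ length (vals b) * length (vals b) →
      Σ ℕ λ m → 2 ^ L ≤ m * m × AtLeastDistinctTau (3 + k) (order L r) m
    choose b le = length (vals b) , ≤-trans total le , atLeastDistinct (deduplicate-! (map (τ b) (allWords L))) real
      where
      real : ∀ {v} → v ∈ vals b → Realisable (3 + k) (order L r) v
      real p with ∈-map⁻ (τ b) (∈-deduplicate⁻ _≟_ (map (τ b) (allWords L)) p)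
      ... | w , _ , refl = realise (closed b w r) (+-comm (2 + k) 1) (size-closed b w r)

  private
    M : ℕ
    M = letterSize

    instance
      M-nonZero : NonZero M
      M-nonZero = _

  -- Padding by steps of type false gains two vertices modulo letterSize.
  padding : ∀ h → h * (1 + 2 * k) * sizeB ≡ h * (2 + k * letterSize)
  padding h = solve 2 (λ h k → h :* (con 1 :+ con 2 :* k) :* (k :* (con 4 :+ k) :+ con 2)
    := h :* (con 2 :+ k :* ((con 1 :+ k) :* (con 4 :+ k) :+ con 2 :+ (k :* (con 4 :+ k) :+ con 2)))) refl h k
    where open +-*-Solver

  -- In `base`, one `M` pays for the letter in the cap, one for the `M` added to the remainder, and
  -- `k * M * M` is a reserve from which the padding is paid. `offset` bounds the part of the order
  -- not due to the `L` letters, as `h ≤ M`.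
  base offset : ℕ
  base = 8 + 2 * k + (2 * M + k * M * M)
  offset = 8 + 2 * k + (M + M * (2 + k * M))

  private
    odd-product : ∀ j y → (3 + 2 * j) * suc (2 * y) ≡ suc (2 * (1 + j + 3 * y + 2 * (j * y)))
    odd-product = solve 2 (λ j y → (con 3 :+ con 2 :* j) :* (con 1 :+ con 2 :* y)
      := con 1 :+ con 2 :* (con 1 :+ j :+ con 3 :* y :+ con 2 :* (j :* y))) refl
      where open +-*-Solver

    odd≢2∣ : ∀ x → 2 ∣ suc (2 * x) → ⊥
    odd≢2∣ x (divides c e) = even≢odd c x (trans (*-comm 2 c) (sym e))

    half≤ : ∀ {h m} → 2 * h ≤ 2 * m → h ≤ m
    half≤ = *-cancelˡ-≤ 2

  -- If k is odd then so is letterSize, so an odd remainder becomes even by adding letterSize; if k is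
  -- even then so is n, and the remainder is never odd.
  evenRemainder : ∀ {n} q s → n ≡ base + (q * M + s) → s < M → 2 ∣ (3 + k) * n →
    ∃₂ λ c h → M + s ≡ c * M + 2 * h × h ≤ M
  evenRemainder q s n≡ s<M ev with halve s
  -- An even remainder is used as it stands, and the additional `M` becomes one more letter.
  ... | h , inj₁ refl = 1 , h , cong (_+ 2 * h) (sym (*-identityˡ M)) , half≤ (≤-trans (<⇒≤ s<M) (m≤m+n M _))
  evenRemainder {n} q s n≡ s<M ev | x , inj₂ refl = byParity (halve k)
    where
    open +-*-Solver
    byParity : (∃ λ j → k ≡ 2 * j ⊎ k ≡ suc (2 * j)) → ∃₂ λ c h → M + suc (2 * x) ≡ c * M + 2 * h × h ≤ M
    -- The witness is half of `M + s`, expanded for `k = 1 + 2 * j` and `s = 1 + 2 * x`.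
    byParity (j , inj₂ k≡) = 0 , 10 + x + 13 * j + 4 * (j * j) , M+s≡ ,
      half≤ (≤-trans (≤-reflexive (sym M+s≡)) (≤-trans (+-monoʳ-≤ M (<⇒≤ s<M)) (+-monoʳ-≤ M (m≤m+n M 0))))
      where
      M+s≡ : M + suc (2 * x) ≡ 2 * (10 + x + 13 * j + 4 * (j * j))
      M+s≡ = trans (cong (λ k → ((1 + k) * (4 + k) + 2) + (k * (4 + k) + 2) + suc (2 * x)) k≡)
        (solve 2 (λ j x → let k = con 1 :+ con 2 :* j in
            ((con 1 :+ k) :* (con 4 :+ k) :+ con 2) :+ (k :* (con 4 :+ k) :+ con 2) :+ (con 1 :+ con 2 :* x)
            := con 2 :* (con 10 :+ x :+ con 13 :* j :+ con 4 :* (j :* j))) refl j x)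
    byParity (j , inj₁ k≡) = ⊥-elim (odd≢2∣ (1 + j + 3 * y + 2 * (j * y)) (subst (2 ∣_) (odd-product j y) (subst₂ (λ k n → 2 ∣ (3 + k) * n) k≡ n-odd ev)))
      where
      m y : ℕ
      m = (1 + 2 * j) * (2 + j) + 1 + (j * (4 + 2 * j) + 1)
      y = 4 + 2 * j + (2 * m + 2 * j * m * (2 * m)) + (q * m + x)
      M≡ : M ≡ 2 * m
      M≡ = trans (cong (λ k → ((1 + k) * (4 + k) + 2) + (k * (4 + k) + 2)) k≡)
        (solve 1 (λ j → let k = con 2 :* j in ((con 1 :+ k) :* (con 4 :+ k) :+ con 2) :+ (k :* (con 4 :+ k) :+ con 2)
          := con 2 :* ((con 1 :+ con 2 :* j) :* (con 2 :+ j) :+ con 1 :+ (j :* (con 4 :+ con 2 :* j) :+ con 1))) refl j)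
      n-odd : n ≡ suc (2 * y)
      n-odd = trans n≡ (trans (cong₂ (λ k M → 8 + 2 * k + (2 * M + k * M * M) + (q * M + suc (2 * x))) k≡ M≡)
        (solve 4 (λ j m q x → let k = con 2 :* j ; M = con 2 :* m in
          con 8 :+ con 2 :* k :+ (con 2 :* M :+ k :* M :* M) :+ (q :* M :+ (con 1 :+ con 2 :* x))
          := con 1 :+ con 2 :* (con 4 :+ con 2 :* j :+ (con 2 :* m :+ con 2 :* j :* m :* (con 2 :* m)) :+ (q :* m :+ x))) refl j m q x))

  representation : ∀ n → base + 2 * offset ≤ n → 2 ∣ (3 + k) * n → ∃₂ λ L h → n ≡ order L (h * (1 + 2 * k)) × n ≤ L * (2 * M)
  representation n n≥ ev = quotient + c + k * g , h , n≡order , bound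
    where
    open +-*-Solver
    excess : ∃ λ D → base + D ≡ n
    excess = m≤n⇒∃[o]m+o≡n (≤-trans (m≤m+n base _) n≥)
    D = proj₁ excess
    quotient = D / M
    remainder = D % M
    n≡ : n ≡ base + (quotient * M + remainder)
    n≡ = trans (sym (proj₂ excess)) (cong (base +_) (trans (m≡m%n+[m/n]*n D M) (+-comm remainder (quotient * M))))
    even : ∃₂ λ c h → M + remainder ≡ c * M + 2 * h × h ≤ M
    even = evenRemainder quotient remainder n≡ (m%n<n D M) ev
    c = proj₁ even
    h = proj₁ (proj₂ even)
    h≤ : h ≤ M
    h≤ = proj₂ (proj₂ (proj₂ even))
    g = proj₁ (m≤n⇒∃[o]m+o≡n h≤)
    h+g≡ : h + g ≡ M
    h+g≡ = proj₂ (m≤n⇒∃[o]m+o≡n h≤)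
    n≡order : n ≡ order (quotient + c + k * g) (h * (1 + 2 * k))
    n≡order = begin
      n
        ≡⟨ n≡ ⟩
      8 + 2 * k + (2 * M + k * M * M) + (quotient * M + remainder)
        ≡⟨ solve 4 (λ k M q s → con 8 :+ con 2 :* k :+ (con 2 :* M :+ k :* M :* M) :+ (q :* M :+ s)
             := con 8 :+ con 2 :* k :+ (M :+ q :* M :+ k :* M :* M :+ (M :+ s))) refl k M quotient remainder ⟩
      8 + 2 * k + (M + quotient * M + k * M * M + (M + remainder))
        -- One factor `M` of the reserve is split as `h + g`: the part `k * h * M` goes into padding
        -- and the part `k * g * M` is turned back into letters.
        ≡⟨ cong₂ (λ z w → 8 + 2 * k + (M + quotient * M + k * z * M + w)) (sym h+g≡) (proj₁ (proj₂ (proj₂ even))) ⟩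
      8 + 2 * k + (M + quotient * M + k * (h + g) * M + (c * M + 2 * h))
        ≡⟨ solve 6 (λ k M q h g c → con 8 :+ con 2 :* k :+ (M :+ q :* M :+ k :* (h :+ g) :* M :+ (c :* M :+ con 2 :* h))
             := con 8 :+ con 2 :* k :+ ((M :+ (q :+ c :+ k :* g) :* M) :+ h :* (con 2 :+ k :* M))) refl k M quotient h g c ⟩
      8 + 2 * k + (suc (quotient + c + k * g) * M + h * (2 + k * M))
        ≡⟨ cong (λ z → 8 + 2 * k + (suc (quotient + c + k * g) * M + z)) (sym (padding h)) ⟩
      order (quotient + c + k * g) (h * (1 + 2 * k)) ∎
      where open ≡-Reasoning
    L = quotient + c + k * g
    n≤ : n ≤ L * M + offset
    n≤ = begin
      n                                                ≡⟨ n≡order ⟩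
      8 + 2 * k + (suc L * M + h * (1 + 2 * k) * sizeB) ≡⟨ cong (λ z → 8 + 2 * k + (suc L * M + z)) (padding h) ⟩
      8 + 2 * k + (suc L * M + h * (2 + k * M))        ≤⟨ +-monoʳ-≤ (8 + 2 * k) (+-monoʳ-≤ (suc L * M) (*-monoˡ-≤ (2 + k * M) h≤)) ⟩
      8 + 2 * k + (suc L * M + M * (2 + k * M))
        ≡⟨ solve 4 (λ k L M z → con 8 :+ con 2 :* k :+ ((M :+ L :* M) :+ z) := L :* M :+ (con 8 :+ con 2 :* k :+ (M :+ z)))
             refl k L M (M * (2 + k * M)) ⟩
      L * M + offset                                   ∎
      where open ≤-Reasoning
    bound : n ≤ L * (2 * M)
    -- Since `n` is at least `2 * offset`, doubling `n ≤ L * M + offset` lets one copy of `n` absorb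
    -- the offsets.
    bound = +-cancelʳ-≤ n n (L * (2 * M)) (begin
      n + n                           ≤⟨ +-mono-≤ n≤ n≤ ⟩
      (L * M + offset) + (L * M + offset)
        ≡⟨ solve 3 (λ L M o → (L :* M :+ o) :+ (L :* M :+ o) := L :* (con 2 :* M) :+ con 2 :* o) refl L M offset ⟩
      L * (2 * M) + 2 * offset        ≤⟨ +-monoʳ-≤ (L * (2 * M)) (≤-trans (m≤n+m (2 * offset) base) n≥) ⟩
      L * (2 * M) + n                 ∎)
      where open ≤-Reasoning

theorem1p2 : ∀ (k : ℕ) → 3 ≤ k →
    Σ ℕ λ p → Σ ℕ λ q → 1 ≤ p × 1 ≤ q × Σ ℕ λ n₀ →
    ∀ (n : ℕ) → n₀ ≤ n → 2 ∣ k * n →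
    Σ ℕ λ m → 2 ^ (p * n) ≤ m ^ q × AtLeastDistinctTau k n m
theorem1p2 (suc (suc (suc k))) (s≤s (s≤s (s≤s z≤n))) =
    -- The constant is `1 / (4 * letterSize)`: at most `2 * letterSize` vertices are spent per
    -- letter, and the choice between two closings costs a square root.
    1 , 2 * (2 * letterSize) , s≤s z≤n , s≤s z≤n , base + 2 * offset , λ n n≥ ev → many n (representation n n≥ ev)
  where
  open Ladders k using (letterSize)
  open Counting k
  many : ∀ n → (∃₂ λ L h → n ≡ order L (h * (1 + 2 * k)) × n ≤ L * (2 * letterSize)) →
    Σ ℕ λ m → 2 ^ (1 * n) ≤ m ^ (2 * (2 * letterSize)) × AtLeastDistinctTau (3 + k) n m
  many n (L , h , refl , n≤) with manyValues L (h * (1 + 2 * k))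
  ... | m , le , distinct = m , (begin
      2 ^ (1 * n)                    ≡⟨ cong (2 ^_) (*-identityˡ n) ⟩
      2 ^ n                          ≤⟨ ^-monoʳ-≤ 2 n≤ ⟩
      2 ^ (L * (2 * letterSize))     ≡⟨ sym (^-*-assoc 2 L (2 * letterSize)) ⟩
      (2 ^ L) ^ (2 * letterSize)     ≤⟨ ^-monoˡ-≤ (2 * letterSize) le ⟩
      (m * m) ^ (2 * letterSize)     ≡⟨ cong (λ z → (m * z) ^ (2 * letterSize)) (sym (*-identityʳ m)) ⟩
      (m ^ 2) ^ (2 * letterSize)     ≡⟨ ^-*-assoc m 2 (2 * letterSize) ⟩
      m ^ (2 * (2 * letterSize))     ∎) , distinct
    where open ≤-Reasoning
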